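{- Let $p$ be an odd prime, $q\in\mathbb{C}_p$ with $q\neq 1$ and $|q-1|_p<p^{ -1/(p-1)}$, $\lambda\in\mathbb{C}_p$ with $\lambda\ne 0$, and $x\in\mathbb{C}_p$ with $|x|_p\le 1$. For every integer $n\ge 0$, $$\int_{\mathbb{Z}_p}\left([x+y]_q\right)_{n,\lambda}\,d\mu_{ -q}(y)=E_{n,q}(x|\lambda),$$ where $\left([x+y]_q\right)_{n,\lambda}=[x+y]_q\left([x+y]_q-\lambda\right)\cdots\left([x+y]_q-(n-1)\lambda\right)$.
   Context: $\mathbb{Z}_p$ is the ring of $p$-adic integers and $\mathbb{C}_p$ the completion of the algebraic closure of $\mathbb{Q}_p$, with $|p|_p=1/p$. For $|z|_p\le 1$, $q^z=\exp(z\log q)$ and $[z]_q=\frac{1-q^z}{1-q}$; also $[N]_{ -q}=\frac{1-(-q)^N}{1+q}$ for integers $N\ge 0$. The fermionic $p$-adic $q$-integral of a continuous function $f:\mathbb{Z}_p\to\mathbb{C}_p$ is $$\int_{\mathbb{Z}_p}f(y)\,d\mu_{ -q}(y)=\lim_{N\to\infty}\frac{1}{[p^N]_{ -q}}\sum_{y=0}^{p^N-1}f(y)(-q)^y .$$ The degenerate $q$-Euler polynomials $E_{n,q}(x|\lambda)$ are defined by the generating function $$\int_{\mathbb{Z}_p}(1+\lambda t)^{\frac{1}{\lambda}[x+y]_q}\,d\mu_{ -q}(y)=\sum_{n=0}^\infty E_{n,q}(x|\lambda)\frac{t^n}{n!},$$ where $(1+\lambda t)^{z/\lambda}=\exp\left(\frac{z}{\lambda}\log(1+\lambda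 t)\right)$ is expanded as a power series in $t$ and the integral is taken coefficientwise. The degenerate falling factorial is $(z)_{n,\lambda}=z(z-\lambda)(z-2\lambda)\cdots(z-(n-1)\lambda)$, with $(z)_{0,\lambda}=1$. -}

module Defs where

open import Level using (Level; _⊔_)
open import Algebra.Bundles using (CommutativeRing)
open import Algebra.Morphism.Structures using (IsRingHomomorphism)
import Algebra.Properties.AbelianGroup as AbelianGroupProperties
import Algebra.Properties.CommutativeSemigroup as CommutativeSemigroupProperties
import Algebra.Properties.Ring as RingProperties
import Algebra.Properties.Semiring.Exp as Exp
import Algebra.Properties.Semiring.Mult as Mult
import Algebra.Properties.Semiring.Sum as Sum
open import Data.Empty using (⊥-elim)
open import Data.Fin.Base using (Fin; zero; suc; toℕ)
open import Data.Integer.Base as ℤ using (+_)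
import Data.Integer.Properties as ℤ
open import Data.Maybe.Base using (just; nothing)
open import Data.Maybe.Properties using (just-injective)
open import Data.Nat.Base as ℕ using (ℕ; zero; suc; _!; _∸_; NonZero; NonTrivial)
open import Data.Nat.Coprimality using (Coprime; coprime-Bézout)
open import Data.Nat.Divisibility using (_∣_; _∤_; ∣⇒≤; ∣-refl; ∣m+n∣m⇒∣n; n∣m*n; divides)
open import Data.Nat.DivMod using (m≡m%n+[m/n]*n; m%n<n)
open import Data.Nat.GCD using (module Bézout)
open import Data.Nat.Induction using (<-rec)
open import Data.Nat.Primality using (Prime; prime⇒nonTrivial; prime⇒nonZero; prime⇒irreducible)
import Data.Nat.Properties as ℕ
open import Data.Product.Base using (∃-syntax; _×_; _,_; proj₁; proj₂)
open import Data.Rational.Base as ℚ using (ℚ; 0ℚ; 1ℚ)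
import Data.Rational.Properties as ℚ
import Data.Rational.Unnormalised.Base as ℚᵘ
import Data.Rational.Unnormalised.Properties as ℚᵘ
open import Data.Rational.Solver using (module +-*-Solver)
open import Data.Sum.Base using (inj₁; inj₂)
open import Function.Base using (_∘_)
open import Function.Bundles using (_⇔_; Equivalence)
open import Relation.Binary.PropositionalEquality as ≡ using (_≡_; refl; cong; cong₂; subst)
import Relation.Binary.Construct.Add.Supremum.NonStrict as Supremum≤
import Relation.Binary.Construct.Add.Supremum.Strict as Supremum<
open import Relation.Nullary using (¬_; yes; no)
open import Relation.Nullary.Construct.Add.Supremum using (_⁺; [_]; ⊤⁺)

open Supremum≤ ℚ._≤_ using (_≤⁺_; [_]; _≤⊤⁺)
open Supremum< ℚ._<_ using (_<⁺_; [_]; [_]<⊤⁺)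

private variable
  c ℓ : Level

infixl 6 _+⁺_
_+⁺_ : ℚ ⁺ → ℚ ⁺ → ℚ ⁺
[ r ] +⁺ [ s ] = [ r ℚ.+ s ]
[ _ ] +⁺ ⊤⁺    = ⊤⁺
⊤⁺    +⁺ _     = ⊤⁺

-- The non-archimedean absolute value is recorded additively: |x| = p^(- v x),
-- so that |0| = 0 is v 0 = ∞ and the ultrametric inequality reads
-- v (x + y) ≥ min (v x) (v y).  Every absolute value of ℂₚ lies in p^ℚ ∪ {0}.
-- As usual for fields with a total inverse, 0 ⁻¹ is left unspecified.
record ValuedField (c ℓ : Level) : Set (Level.suc (c ⊔ ℓ)) where
  infix 8 _⁻¹
  field
    commutativeRing : CommutativeRing c ℓ
  open CommutativeRing commutativeRing public
    hiding (zero) renaming (refl to ≈-refl; sym to ≈-sym; trans to ≈-trans; reflexive to ≈-reflexive)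
  field
    1≉0      : 1# ≉ 0#
    _⁻¹      : Carrier → Carrier
    ⁻¹-cong  : ∀ {x y} → x ≈ y → x ⁻¹ ≈ y ⁻¹
    *-inverseʳ : ∀ {x} → x ≉ 0# → x * x ⁻¹ ≈ 1#
    v        : Carrier → ℚ ⁺
    v-cong   : ∀ {x y} → x ≈ y → v x ≡ v y
    v-zero   : ∀ x → v x ≡ ⊤⁺ ⇔ x ≈ 0#
    v-*      : ∀ x y → v (x * y) ≡ v x +⁺ v y
    v-+      : ∀ {r} x y → r ≤⁺ v x → r ≤⁺ v y → r ≤⁺ v (x + y)

  open Exp semiring public using (_^_)
  open Mult semiring public using () renaming (_×_ to _·_)
  open Sum semiring public using (sum; sum-syntax; sum⁺-syntax)

  infix 4 _≼_ _≺_ _≈[_]_ _⟶_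

  -- |x| ≤ p^(- r) and |x| < p^(- r).
  _≼_ : ℚ → Carrier → Set
  r ≼ x = [ r ] ≤⁺ v x

  _≺_ : ℚ → Carrier → Set
  r ≺ x = [ r ] <⁺ v x

  _≈[_]_ : Carrier → ℚ → Carrier → Set
  x ≈[ r ] y = r ≼ x - y

  _⟶_ : (ℕ → Carrier) → Carrier → Set
  s ⟶ L = ∀ r → ∃[ N ] ∀ n → N ℕ.≤ n → s n ≈[ r ] L

  Cauchy : (ℕ → Carrier) → Set
  Cauchy s = ∀ r → ∃[ N ] ∀ m n → N ℕ.≤ m → N ℕ.≤ n → s m ≈[ r ] s n

  Complete : Set c
  Complete = ∀ s → Cauchy s → ∃[ L ] s ⟶ L

  ⟦_⟧ : ℕ → Carrier
  ⟦ n ⟧ = n · 1#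

-- |x| ≤ 1; for K = ℚₚ this is ℤₚ.
record 𝒪 (K : ValuedField c ℓ) : Set c where
  constructor ⟪_,_⟫
  open ValuedField K using (Carrier; _≼_)
  field
    elt      : Carrier
    integral : 0ℚ ≼ elt
open 𝒪 public using (elt; integral)

record Embedding (K L : ValuedField c ℓ) : Set (c ⊔ ℓ) where
  private
    module K = ValuedField K
    module L = ValuedField L
  field
    map                : K.Carrier → L.Carrier
    isRingHomomorphism : IsRingHomomorphism K.rawRing L.rawRing map
    isometric          : ∀ x → L.v (map x) ≡ K.v x
open Embedding public using (map)

module _ {a} {A : Set a} (L : ValuedField c ℓ) (ι : A → ValuedField.Carrier L) where
  open ValuedField L

  record IsCompletion : Set (a ⊔ c ⊔ ℓ) where
    field
      complete : Complete
      dense    : ∀ x r → ∃[ y ] x ≈[ r ] ι y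

module _ (K : ValuedField c ℓ) where
  open ValuedField K

  monic : ∀ {n} → (Fin n → Carrier) → Carrier → Carrier
  monic {n} a x = x ^ n + ∑[ i < n ] (a i * x ^ toℕ i)

record IsAlgebraicClosure {K L : ValuedField c ℓ} (ι : Embedding K L) : Set (c ⊔ ℓ) where
  open ValuedField L using (Carrier; _≈_; 0#)
  field
    algebraic : ∀ x → ∃[ n ] ∃[ a ] monic L {n} (map ι ∘ a) x ≈ 0#
    closed    : ∀ n (a : Fin (suc n) → Carrier) → ∃[ x ] monic L a x ≈ 0#

-- ℂₚ as the last term of ℚ → ℚₚ → ℚ̄ₚ → ℂₚ.  The only valuation on ℚ with
-- v p = 1 is the p-adic one, and it extends uniquely along the tower.
record PAdicTower (p : ℕ) (c ℓ : Level) : Set (Level.suc (c ⊔ ℓ)) where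
  field
    ℚₚ ℚ̄ₚ ℂₚ : ValuedField c ℓ
    ι₀ : ℚ → ValuedField.Carrier ℚₚ
    ι₀-isRingHomomorphism : IsRingHomomorphism ℚ.+-*-rawRing (ValuedField.rawRing ℚₚ) ι₀
    v-p : ValuedField.v ℚₚ (ValuedField.⟦_⟧ ℚₚ p) ≡ [ 1ℚ ]
    ι₀-isCompletion : IsCompletion ℚₚ ι₀
    ι₁ : Embedding ℚₚ ℚ̄ₚ
    ι₁-isAlgebraicClosure : IsAlgebraicClosure ι₁
    ι₂ : Embedding ℚ̄ₚ ℂₚ
    ι₂-isCompletion : IsCompletion ℂₚ (map ι₂)

fromℚᵘ-+ : ∀ a b → ℚ.fromℚᵘ a ℚ.+ ℚ.fromℚᵘ b ≡ ℚ.fromℚᵘ (a ℚᵘ.+ b)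
fromℚᵘ-+ a b = ℚ.toℚᵘ-injective (ℚᵘ.≃-trans (ℚ.toℚᵘ-homo-+ (ℚ.fromℚᵘ a) (ℚ.fromℚᵘ b))
  (ℚᵘ.≃-trans (ℚᵘ.+-cong (ℚ.toℚᵘ-fromℚᵘ a) (ℚ.toℚᵘ-fromℚᵘ b)) (ℚᵘ.≃-sym (ℚ.toℚᵘ-fromℚᵘ (a ℚᵘ.+ b)))))

fromℚᵘ-* : ∀ a b → ℚ.fromℚᵘ a ℚ.* ℚ.fromℚᵘ b ≡ ℚ.fromℚᵘ (a ℚᵘ.* b)
fromℚᵘ-* a b = ℚ.toℚᵘ-injective (ℚᵘ.≃-trans (ℚ.toℚᵘ-homo-* (ℚ.fromℚᵘ a) (ℚ.fromℚᵘ b))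
  (ℚᵘ.≃-trans (ℚᵘ.*-cong (ℚ.toℚᵘ-fromℚᵘ a) (ℚ.toℚᵘ-fromℚᵘ b)) (ℚᵘ.≃-sym (ℚ.toℚᵘ-fromℚᵘ (a ℚᵘ.* b)))))

fromℚᵘ-mono : ∀ {a b} → a ℚᵘ.≤ b → ℚ.fromℚᵘ a ℚ.≤ ℚ.fromℚᵘ b
fromℚᵘ-mono {a} {b} a≤b = ℚ.toℚᵘ-cancel-≤ (ℚᵘ.≤-trans (ℚᵘ.≤-reflexive (ℚ.toℚᵘ-fromℚᵘ a))
  (ℚᵘ.≤-trans a≤b (ℚᵘ.≤-reflexive (ℚᵘ.≃-sym (ℚ.toℚᵘ-fromℚᵘ b)))))

opaque

  fromℕ : ℕ → ℚ
  fromℕ n = + n ℚ./ 1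

  fromℕ-+ : ∀ m n → fromℕ (m ℕ.+ n) ≡ fromℕ m ℚ.+ fromℕ n
  fromℕ-+ m n = ≡.trans (ℚ.fromℚᵘ-cong {ℚᵘ.mkℚᵘ (+ (m ℕ.+ n)) 0} {ℚᵘ.mkℚᵘ (+ m) 0 ℚᵘ.+ ℚᵘ.mkℚᵘ (+ n) 0}
                           (ℚᵘ.*≡* (cong (ℤ._* + 1) (cong₂ ℤ._+_ (≡.sym (ℤ.*-identityʳ (+ m))) (≡.sym (ℤ.*-identityʳ (+ n)))))))
                        (≡.sym (fromℚᵘ-+ (ℚᵘ.mkℚᵘ (+ m) 0) (ℚᵘ.mkℚᵘ (+ n) 0)))

  fromℕ-mono : ∀ {m n} → m ℕ.≤ n → fromℕ m ℚ.≤ fromℕ n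
  fromℕ-mono {m} {n} m≤n = fromℚᵘ-mono {ℚᵘ.mkℚᵘ (+ m) 0} {ℚᵘ.mkℚᵘ (+ n) 0} (ℚᵘ.*≤* (ℤ.*-monoʳ-≤-nonNeg (+ 1) (ℤ.+≤+ m≤n)))

  fromℕ-≥0 : ∀ n → 0ℚ ℚ.≤ fromℕ n
  fromℕ-≥0 n = fromℕ-mono {0} {n} ℕ.z≤n

  *≤⇒≤*1/ : ∀ e m d .{{_ : NonZero d}} → e ℕ.* d ℕ.≤ m → fromℕ e ℚ.≤ fromℕ m ℚ.* (+ 1 ℚ./ d)
  *≤⇒≤*1/ e m (suc d) ed≤m = subst (fromℕ e ℚ.≤_) (≡.sym (fromℚᵘ-* (ℚᵘ.mkℚᵘ (+ m) 0) (ℚᵘ.mkℚᵘ (+ 1) d)))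
    (fromℚᵘ-mono {ℚᵘ.mkℚᵘ (+ e) 0} {ℚᵘ.mkℚᵘ (+ m) 0 ℚᵘ.* ℚᵘ.mkℚᵘ (+ 1) d} (ℚᵘ.*≤* (≡.subst₂ ℤ._≤_ (ℤ.pos-* e (suc (d ℕ.+ 0))) (≡.trans (ℤ.pos-* (m ℕ.* 1) 1) (cong (ℤ._* + 1) (ℤ.pos-* m 1))) (ℤ.+≤+ le))))
    where
    le : e ℕ.* (suc (d ℕ.+ 0)) ℕ.≤ m ℕ.* 1 ℕ.* 1
    le = ≡.subst₂ ℕ._≤_ (cong (λ k → e ℕ.* suc k) (≡.sym (ℕ.+-identityʳ d)))
           (≡.sym (≡.trans (ℕ.*-identityʳ _) (ℕ.*-identityʳ m))) ed≤m

  archimedean : ∀ {δ} → 0ℚ ℚ.< δ → ∀ r → ∃[ N ] r ℚ.≤ fromℕ N ℚ.* δ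
  archimedean {δ@(ℚ.mkℚ (+ zero) d _)} 0<δ r = ⊥-elim (ℚ.<-irrefl refl (ℚ.<-≤-trans 0<δ (ℚ.nonPositive⁻¹ δ)))
  archimedean {δ@(ℚ.mkℚ (ℤ.-[1+ k ]) d _)} 0<δ r = ⊥-elim (ℚ.<-irrefl refl (ℚ.<-≤-trans 0<δ (ℚ.nonPositive⁻¹ δ)))
  archimedean {δ@(ℚ.mkℚ (+ suc k) d _)} 0<δ r@(ℚ.mkℚ a b _) = N , ≡.subst₂ ℚ._≤_ (ℚ.fromℚᵘ-toℚᵘ r)
      (≡.trans (≡.sym (fromℚᵘ-* (ℚᵘ.mkℚᵘ (+ N) 0) (ℚ.toℚᵘ δ))) (cong (fromℕ N ℚ.*_) (ℚ.fromℚᵘ-toℚᵘ δ)))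
      (fromℚᵘ-mono {ℚ.toℚᵘ r} {ℚᵘ.mkℚᵘ (+ N) 0 ℚᵘ.* ℚ.toℚᵘ δ} (ℚᵘ.*≤* (ℤ.≤-trans (ℤ.*-monoʳ-≤-nonNeg (+ suc (d ℕ.+ 0)) a≤)
        (≡.subst₂ ℤ._≤_ (ℤ.pos-* ℤ.∣ a ∣ (suc (d ℕ.+ 0))) (≡.trans (ℤ.pos-* (N ℕ.* suc k) (suc b)) (cong (ℤ._* + suc b) (ℤ.pos-* N (suc k)))) (ℤ.+≤+ le)))))
    where
    N : ℕ
    N = ℤ.∣ a ∣ ℕ.* suc d
    a≤ : a ℤ.≤ + ℤ.∣ a ∣
    a≤ = ≤∣∣ a
      where
      ≤∣∣ : ∀ z → z ℤ.≤ + ℤ.∣ z ∣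
      ≤∣∣ (+ n) = ℤ.≤-refl
      ≤∣∣ (ℤ.-[1+ n ]) = ℤ.-≤+
    le : ℤ.∣ a ∣ ℕ.* suc (d ℕ.+ 0) ℕ.≤ N ℕ.* suc k ℕ.* suc b
    le = ℕ.≤-trans (ℕ.≤-reflexive (cong (λ j → ℤ.∣ a ∣ ℕ.* suc j) (ℕ.+-identityʳ d)))
           (ℕ.≤-trans (ℕ.m≤m*n N (suc k)) (ℕ.m≤m*n (N ℕ.* suc k) (suc b)))

  fromℕ-0 : fromℕ 0 ≡ 0ℚ
  fromℕ-0 = refl

  fromℕ-1 : fromℕ 1 ≡ 1ℚ
  fromℕ-1 = refl

*1-archimedean : ∀ r → ∃[ N ] r ℚ.≤ fromℕ N
*1-archimedean r = let N , r≤ = archimedean (ℚ.positive⁻¹ 1ℚ) r in N , subst (r ℚ.≤_) (ℚ.*-identityʳ (fromℕ N)) r≤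

≤⁺-trans : ∀ {a b c} → a ≤⁺ b → b ≤⁺ c → a ≤⁺ c
≤⁺-trans = Supremum≤.≤⁺-trans ℚ._≤_ ℚ.≤-trans

≤⁺-reflexive : ∀ {a b} → a ≡ b → a ≤⁺ b
≤⁺-reflexive = Supremum≤.≤⁺-reflexive-≡ ℚ._≤_ ℚ.≤-reflexive

+⁺-mono : ∀ {r s a b} → [ r ] ≤⁺ a → [ s ] ≤⁺ b → [ r ℚ.+ s ] ≤⁺ a +⁺ b
+⁺-mono [ p ]      [ q ]      = [ ℚ.+-mono-≤ p q ]
+⁺-mono [ p ]      (_ ≤⊤⁺)    = _ ≤⊤⁺
+⁺-mono (_ ≤⊤⁺)    _          = _ ≤⊤⁺

r≡r+r⇒r≡0 : ∀ r → r ≡ r ℚ.+ r → r ≡ 0ℚ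
r≡r+r⇒r≡0 r eq = begin
  r                   ≡⟨ solve 1 (λ r → r := (r :+ r) :- r) refl r ⟩
  (r ℚ.+ r) ℚ.- r     ≡⟨ cong (ℚ._- r) (≡.sym eq) ⟩
  r ℚ.- r             ≡⟨ ℚ.+-inverseʳ r ⟩
  0ℚ                  ∎
  where
  open +-*-Solver
  open ≡.≡-Reasoning

0≤r+r⇒0≤r : ∀ r → 0ℚ ℚ.≤ r ℚ.+ r → 0ℚ ℚ.≤ r
0≤r+r⇒0≤r r 0≤2r with ℚ.≤-total 0ℚ r
... | inj₁ 0≤r = 0≤r
... | inj₂ r≤0 = ℚ.≤-trans 0≤2r (subst (r ℚ.+ r ℚ.≤_) (ℚ.+-identityˡ r) (ℚ.+-monoˡ-≤ r r≤0))

module ValuedFieldProperties (K : ValuedField c ℓ) where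
  open ValuedField K
  open RingProperties ring using (-‿distribˡ-*; -‿distribʳ-*; -‿involutive; -0#≈0#)
  open AbelianGroupProperties +-abelianGroup using () renaming (⁻¹-∙-comm to -‿+-comm)
  open CommutativeSemigroupProperties +-commutativeSemigroup using (interchange)
  open import Relation.Binary.Reasoning.Setoid setoid

  opaque

    ≼-mono : ∀ {r s x} → s ℚ.≤ r → r ≼ x → s ≼ x
    ≼-mono s≤r = ≤⁺-trans [ s≤r ]

    ≼-resp : ∀ {r x y} → x ≈ y → r ≼ x → r ≼ y
    ≼-resp {r} x≈y = subst ([ r ] ≤⁺_) (v-cong x≈y)

    v≡ : ∀ {r x} → v x ≡ [ r ] → r ≼ x
    v≡ eq = ≤⁺-reflexive (≡.sym eq)

    v≈0 : ∀ {x} → x ≈ 0# → v x ≡ ⊤⁺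
    v≈0 = Equivalence.from (v-zero _)

    ≼-0 : ∀ {r} → r ≼ 0#
    ≼-0 {r} = subst ([ r ] ≤⁺_) (≡.sym (v≈0 ≈-refl)) ([ r ] ≤⊤⁺)

    ≼-≈0 : ∀ {r x} → x ≈ 0# → r ≼ x
    ≼-≈0 x≈0 = ≼-resp (≈-sym x≈0) ≼-0

    ≼-+ : ∀ {r x y} → r ≼ x → r ≼ y → r ≼ x + y
    ≼-+ = v-+ _ _

    ≼-* : ∀ {r s x y} → r ≼ x → s ≼ y → r ℚ.+ s ≼ x * y
    ≼-* {r} {s} {x} {y} p q = subst ([ r ℚ.+ s ] ≤⁺_) (≡.sym (v-* x y)) (+⁺-mono p q)

    ≼-*ˡ : ∀ {r x y} → 0ℚ ≼ x → r ≼ y → r ≼ x * y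
    ≼-*ˡ {r} p q = subst (_≼ _) (ℚ.+-identityˡ r) (≼-* p q)

    ≼-*ʳ : ∀ {r x y} → r ≼ x → 0ℚ ≼ y → r ≼ x * y
    ≼-*ʳ {r} p q = subst (_≼ _) (ℚ.+-identityʳ r) (≼-* p q)

    finite : ∀ {x} → x ≉ 0# → ∃[ r ] v x ≡ [ r ]
    finite {x} x≉0 with v x in eq
    ... | just r  = r , refl
    ... | nothing = ⊥-elim (x≉0 (Equivalence.to (v-zero x) eq))

    v≢⊤⇒≉0 : ∀ {x r} → v x ≡ [ r ] → x ≉ 0#
    v≢⊤⇒≉0 eq x≈0 with () ← ≡.trans (≡.sym eq) (v≈0 x≈0)

    v-1 : v 1# ≡ [ 0ℚ ]
    v-1 with finite 1≉0
    ... | r , eq = ≡.trans eq (cong [_] (r≡r+r⇒r≡0 r (just-injective (≡.trans (≡.sym eq)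
      (≡.trans (v-cong (≈-sym (*-identityˡ 1#))) (≡.trans (v-* 1# 1#) (cong₂ _+⁺_ eq eq)))))))

    ≼-1 : 0ℚ ≼ 1#
    ≼-1 = v≡ v-1

    -1*-1≈1 : - 1# * - 1# ≈ 1#
    -1*-1≈1 = begin
      - 1# * - 1#     ≈⟨ -‿distribˡ-* 1# (- 1#) ⟨
      - (1# * - 1#)   ≈⟨ -‿cong (*-identityˡ (- 1#)) ⟩
      - (- 1#)        ≈⟨ -‿involutive 1# ⟩
      1#              ∎

    ≼-−1 : 0ℚ ≼ - 1#
    ≼-−1 = helper (v (- 1#)) (≤⁺-trans ≼-1 (≤⁺-reflexive (≡.trans (v-cong (≈-sym -1*-1≈1)) (v-* _ _))))
      where
      helper : ∀ a → [ 0ℚ ] ≤⁺ a +⁺ a → [ 0ℚ ] ≤⁺ a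
      helper (just r) [ p ] = [ 0≤r+r⇒0≤r r p ]
      helper nothing  _     = _ ≤⊤⁺

    -1*x≈-x : ∀ x → - 1# * x ≈ - x
    -1*x≈-x x = ≈-trans (≈-sym (-‿distribˡ-* 1# x)) (-‿cong (*-identityˡ x))

    ≼-neg : ∀ {r x} → r ≼ x → r ≼ - x
    ≼-neg p = ≼-resp (-1*x≈-x _) (≼-*ˡ ≼-−1 p)

    ≼-^ : ∀ {s x} → s ≼ x → ∀ n → fromℕ n ℚ.* s ≼ x ^ n
    ≼-^ {s} p zero    = subst (_≼ 1#) (≡.sym (≡.trans (cong (ℚ._* s) fromℕ-0) (ℚ.*-zeroˡ s))) ≼-1
    ≼-^ {s} {x} p (suc n) = subst (_≼ x ^ suc n) (≡.sym eq) (≼-* p (≼-^ p n))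
      where
      eq : fromℕ (suc n) ℚ.* s ≡ s ℚ.+ fromℕ n ℚ.* s
      eq = ≡.trans (cong (ℚ._* s) (≡.trans (fromℕ-+ 1 n) (cong (ℚ._+ fromℕ n) fromℕ-1)))
             (solve 2 (λ n s → (con 1ℚ :+ n) :* s := s :+ n :* s) refl (fromℕ n) s)
        where open +-*-Solver

    ≼-^0 : ∀ {x} → 0ℚ ≼ x → ∀ n → 0ℚ ≼ x ^ n
    ≼-^0 {x} p n = subst (_≼ x ^ n) (ℚ.*-zeroʳ (fromℕ n)) (≼-^ p n)

    ≼-sum : ∀ {r} n (f : Fin n → Carrier) → (∀ i → r ≼ f i) → r ≼ sum f
    ≼-sum zero    f p = ≼-0
    ≼-sum (suc n) f p = ≼-+ (p zero) (≼-sum n (f ∘ suc) (p ∘ suc))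

    ≼-⟦⟧ : ∀ n → 0ℚ ≼ ⟦ n ⟧
    ≼-⟦⟧ zero    = ≼-0
    ≼-⟦⟧ (suc n) = ≼-+ ≼-1 (≼-⟦⟧ n)

    v-⁻¹ : ∀ {x r} → v x ≡ [ r ] → v (x ⁻¹) ≡ [ ℚ.- r ]
    v-⁻¹ {x} {r} eq = helper (v (x ⁻¹))
      (≡.trans (≡.sym (cong (_+⁺ v (x ⁻¹)) eq)) (≡.trans (≡.sym (v-* x (x ⁻¹))) (≡.trans (v-cong (*-inverseʳ (v≢⊤⇒≉0 eq))) v-1)))
      where
      helper : ∀ a → [ r ] +⁺ a ≡ [ 0ℚ ] → a ≡ [ ℚ.- r ]
      helper (just s) e = cong [_] (≡.trans (solve 2 (λ r s → s := (r :+ s) :- r) refl r s)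
        (≡.trans (cong (ℚ._- r) (just-injective e)) (ℚ.+-identityˡ (ℚ.- r))))
        where open +-*-Solver

    ≈[]-reflexive : ∀ {r x y} → x ≈ y → x ≈[ r ] y
    ≈[]-reflexive {x = x} {y} x≈y = ≼-≈0 (≈-trans (+-congʳ x≈y) (-‿inverseʳ y))

    ≈[]-sym : ∀ {r x y} → x ≈[ r ] y → y ≈[ r ] x
    ≈[]-sym {x = x} {y} p = ≼-resp
      (≈-trans (≈-sym (-‿+-comm x (- y))) (≈-trans (+-comm _ _) (+-congʳ (-‿involutive y)))) (≼-neg p)

    ≈[]-trans : ∀ {r x y z} → x ≈[ r ] y → y ≈[ r ] z → x ≈[ r ] z
    ≈[]-trans {x = x} {y} {z} p q = ≼-resp (begin
      (x - y) + (y - z)     ≈⟨ +-assoc x (- y) (y - z) ⟩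
      x + (- y + (y - z))   ≈⟨ +-congˡ (+-assoc (- y) y (- z)) ⟨
      x + ((- y + y) - z)   ≈⟨ +-congˡ (+-congʳ (-‿inverseˡ y)) ⟩
      x + (0# - z)          ≈⟨ +-congˡ (+-identityˡ (- z)) ⟩
      x - z                 ∎) (≼-+ p q)

    ≈[]-resp : ∀ {r x x′ y y′} → x ≈ x′ → y ≈ y′ → x ≈[ r ] y → x′ ≈[ r ] y′
    ≈[]-resp x≈x′ y≈y′ = ≼-resp (+-cong x≈x′ (-‿cong y≈y′))

    ≈[]-mono : ∀ {r s x y} → s ℚ.≤ r → x ≈[ r ] y → x ≈[ s ] y
    ≈[]-mono = ≼-mono

    ≈[]-≼ : ∀ {r x y} → x ≈[ r ] y → r ≼ y → r ≼ x
    ≈[]-≼ {x = x} {y} p q = ≼-resp (begin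
      (x - y) + y   ≈⟨ +-assoc x (- y) y ⟩
      x + (- y + y) ≈⟨ +-congˡ (-‿inverseˡ y) ⟩
      x + 0#        ≈⟨ +-identityʳ x ⟩
      x             ∎) (≼-+ p q)

    ≈[]-+ : ∀ {r x x′ y y′} → x ≈[ r ] x′ → y ≈[ r ] y′ → x + y ≈[ r ] x′ + y′
    ≈[]-+ {x = x} {x′} {y} {y′} p q = ≼-resp
      (≈-trans (interchange x (- x′) y (- y′)) (+-congˡ (-‿+-comm x′ y′))) (≼-+ p q)

    *-distribˡ-− : ∀ x y z → x * (y - z) ≈ x * y - x * z
    *-distribˡ-− x y z = ≈-trans (distribˡ x y (- z)) (+-congˡ (≈-sym (-‿distribʳ-* x z)))

    *-distribʳ-− : ∀ x y z → (y - z) * x ≈ y * x - z * x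
    *-distribʳ-− x y z = ≈-trans (distribʳ x y (- z)) (+-congˡ (≈-sym (-‿distribˡ-* z x)))

    ≈[]-*ˡ : ∀ {r s x y y′} → s ≼ x → y ≈[ r ] y′ → x * y ≈[ s ℚ.+ r ] x * y′
    ≈[]-*ˡ p q = ≼-resp (*-distribˡ-− _ _ _) (≼-* p q)

    ≈[]-*ʳ : ∀ {r s x x′ y} → x ≈[ r ] x′ → s ≼ y → x * y ≈[ r ℚ.+ s ] x′ * y
    ≈[]-*ʳ p q = ≼-resp (*-distribʳ-− _ _ _) (≼-* p q)

    ≈[]-*ˡ0 : ∀ {r x y y′} → 0ℚ ≼ x → y ≈[ r ] y′ → x * y ≈[ r ] x * y′
    ≈[]-*ˡ0 {r} p q = subst (_ ≈[_] _) (ℚ.+-identityˡ r) (≈[]-*ˡ p q)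

    ≈[]-*ʳ0 : ∀ {r x x′ y} → x ≈[ r ] x′ → 0ℚ ≼ y → x * y ≈[ r ] x′ * y
    ≈[]-*ʳ0 {r} p q = subst (_ ≈[_] _) (ℚ.+-identityʳ r) (≈[]-*ʳ p q)

    ≈[]-neg : ∀ {r x y} → x ≈[ r ] y → - x ≈[ r ] - y
    ≈[]-neg {x = x} {y} p = ≼-resp (≈-sym (-‿+-comm x (- y))) (≼-neg p)

    ≈[]-sum : ∀ {r} n (f g : Fin n → Carrier) → (∀ i → f i ≈[ r ] g i) → sum f ≈[ r ] sum g
    ≈[]-sum zero    f g p = ≈[]-reflexive ≈-refl
    ≈[]-sum (suc n) f g p = ≈[]-+ (p zero) (≈[]-sum n (f ∘ suc) (g ∘ suc) (p ∘ suc))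

    sum-split : ∀ m n (f : ℕ → Carrier) → ∑[ i < m ℕ.+ n ] f (toℕ i) ≈ ∑[ i < m ] f (toℕ i) + ∑[ i < n ] f (m ℕ.+ toℕ i)
    sum-split zero    n f = ≈-sym (+-identityˡ _)
    sum-split (suc m) n f = ≈-trans (+-congˡ (sum-split m n (f ∘ suc))) (≈-sym (+-assoc _ _ _))

    sum-suc : ∀ n (f : ℕ → Carrier) → ∑[ i < suc n ] f (toℕ i) ≈ ∑[ i < n ] f (toℕ i) + f n
    sum-suc n f = begin
      ∑[ i < suc n ] f (toℕ i)               ≡⟨ cong (λ k → ∑[ i < k ] f (toℕ i)) (ℕ.+-comm 1 n) ⟩
      ∑[ i < n ℕ.+ 1 ] f (toℕ i)             ≈⟨ sum-split n 1 f ⟩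
      ∑[ i < n ] f (toℕ i) + (f (n ℕ.+ 0) + 0#) ≈⟨ +-congˡ (+-identityʳ _) ⟩
      ∑[ i < n ] f (toℕ i) + f (n ℕ.+ 0)     ≡⟨ cong (λ k → ∑[ i < n ] f (toℕ i) + f k) (ℕ.+-identityʳ n) ⟩
      ∑[ i < n ] f (toℕ i) + f n             ∎

    cauchy : ∀ s → (∀ r → ∃[ N ] ∀ n → N ℕ.≤ n → s (suc n) ≈[ r ] s n) → Cauchy s
    cauchy s step r = let N , p = step r in N , λ m n N≤m N≤n → ≈[]-trans (tail N p m N≤m) (≈[]-sym (tail N p n N≤n))
      where
      tail′ : ∀ N → (∀ n → N ℕ.≤ n → s (suc n) ≈[ r ] s n) → ∀ k → s (k ℕ.+ N) ≈[ r ] s N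
      tail′ N p zero    = ≈[]-reflexive ≈-refl
      tail′ N p (suc k) = ≈[]-trans (p (k ℕ.+ N) (ℕ.m≤n+m N k)) (tail′ N p k)
      tail : ∀ N → (∀ n → N ℕ.≤ n → s (suc n) ≈[ r ] s n) → ∀ n → N ℕ.≤ n → s n ≈[ r ] s N
      tail N p n N≤n = subst (λ k → s k ≈[ r ] s N) (ℕ.m∸n+n≡m N≤n) (tail′ N p (n ∸ N))

    ⟶-≼ : ∀ {r s L} → s ⟶ L → (∀ n → r ≼ s n) → r ≼ L
    ⟶-≼ {r} lim p = let N , q = lim r in ≈[]-≼ (≈[]-sym (q N ℕ.≤-refl)) (p N)

    ⟶-≈[] : ∀ {r s t L M} → s ⟶ L → t ⟶ M → (∀ n → s n ≈[ r ] t n) → L ≈[ r ] M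
    ⟶-≈[] {r} lim₁ lim₂ p =
      let N₁ , q₁ = lim₁ r
          N₂ , q₂ = lim₂ r
          N = N₁ ℕ.⊔ N₂
      in ≈[]-trans (≈[]-sym (q₁ N (ℕ.m≤m⊔n N₁ N₂))) (≈[]-trans (p N) (q₂ N (ℕ.m≤n⊔m N₁ N₂)))

+⁺-assoc : ∀ a b c → (a +⁺ b) +⁺ c ≡ a +⁺ (b +⁺ c)
+⁺-assoc (just a) (just b) (just c) = cong [_] (ℚ.+-assoc a b c)
+⁺-assoc (just a) (just b) nothing  = refl
+⁺-assoc (just a) nothing  c        = refl
+⁺-assoc nothing  b        c        = refl

+⁺-comm : ∀ a b → a +⁺ b ≡ b +⁺ a
+⁺-comm (just a) (just b) = cong [_] (ℚ.+-comm a b)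
+⁺-comm (just a) nothing  = refl
+⁺-comm nothing  (just b) = refl
+⁺-comm nothing  nothing  = refl

+⁺-identityˡ : ∀ a → [ 0ℚ ] +⁺ a ≡ a
+⁺-identityˡ (just a) = cong [_] (ℚ.+-identityˡ a)
+⁺-identityˡ nothing  = refl

pred-nonZero : ∀ {p} → .{{NonTrivial p}} → NonZero (p ∸ 1)
pred-nonZero {suc (suc _)} = _

1/[p-1] : ∀ {p} → Prime p → ℚ
1/[p-1] {p} isPrime = (+ 1 ℚ./ (p ∸ 1)) {{pred-nonZero {{prime⇒nonTrivial isPrime}}}}

module NaturalNumbers (K : ValuedField c ℓ) {p : ℕ} (isPrime : Prime p)
                      (v-p : ValuedField.v K (ValuedField.⟦_⟧ K p) ≡ [ 1ℚ ]) where
  open ValuedField K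
  open ValuedFieldProperties K
  open Mult semiring using (×1-homo-*; ×-homo-+)
  private instance
    nonTrivial-p : NonTrivial p
    nonTrivial-p = prime⇒nonTrivial isPrime
    nonZero-p : NonZero p
    nonZero-p = prime⇒nonZero isPrime

  opaque

    ⟦⟧-* : ∀ m n → ⟦ m ℕ.* n ⟧ ≈ ⟦ m ⟧ * ⟦ n ⟧
    ⟦⟧-* = ×1-homo-*

    ⟦⟧-+ : ∀ m n → ⟦ m ℕ.+ n ⟧ ≈ ⟦ m ⟧ + ⟦ n ⟧
    ⟦⟧-+ = ×-homo-+ 1#

    v-⟦*⟧ : ∀ m n → v ⟦ m ℕ.* n ⟧ ≡ v ⟦ m ⟧ +⁺ v ⟦ n ⟧
    v-⟦*⟧ m n = ≡.trans (v-cong (⟦⟧-* m n)) (v-* ⟦ m ⟧ ⟦ n ⟧)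

    ¬≼-1 : ∀ {r} → 0ℚ ℚ.< r → ¬ r ≼ 1#
    ¬≼-1 {r} 0<r r≼1 with subst ([ r ] ≤⁺_) v-1 r≼1
    ... | [ r≤0 ] = ℚ.<-irrefl refl (ℚ.<-≤-trans 0<r r≤0)

    v≡0 : ∀ {x} → 0ℚ ≼ x → (∀ r → 0ℚ ℚ.< r → ¬ r ≼ x) → v x ≡ [ 0ℚ ]
    v≡0 {x} 0≼x small = helper (v x) 0≼x small
      where
      helper : ∀ a → [ 0ℚ ] ≤⁺ a → (∀ r → 0ℚ ℚ.< r → ¬ [ r ] ≤⁺ a) → a ≡ [ 0ℚ ]
      helper nothing  _       h = ⊥-elim (h 1ℚ (ℚ.positive⁻¹ 1ℚ) (_ ≤⊤⁺))
      helper (just r) [ 0≤r ] h with r ℚ.≤? 0ℚ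
      ... | yes r≤0 = cong [_] (ℚ.≤-antisym r≤0 0≤r)
      ... | no r≰0  = ⊥-elim (h r (ℚ.≰⇒> r≰0) [ ℚ.≤-refl ])

    ≼⇒≈[]0 : ∀ {r x} → r ≼ x → x ≈[ r ] 0#
    ≼⇒≈[]0 {x = x} = ≼-resp (≈-sym (≈-trans (+-congˡ -0#≈0#) (+-identityʳ x)))
      where open RingProperties ring using (-0#≈0#)

    positive-≤ : ∀ r s → 0ℚ ℚ.< r → 0ℚ ℚ.< s → ∃[ t ] 0ℚ ℚ.< t × t ℚ.≤ r × t ℚ.≤ s
    positive-≤ r s 0<r 0<s with ℚ.≤-total r s
    ... | inj₁ r≤s = r , 0<r , ℚ.≤-refl , r≤s
    ... | inj₂ s≤r = s , 0<s , s≤r , ℚ.≤-refl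

    v-∤ : ∀ {m} → p ∤ m → v ⟦ m ⟧ ≡ [ 0ℚ ]
    v-∤ {m} p∤m = v≡0 (≼-⟦⟧ m) λ r 0<r r≼m →
      let t , 0<t , t≤r , t≤1 = positive-≤ r 1ℚ 0<r (ℚ.positive⁻¹ 1ℚ)
      in ¬≼-1 0<t (one (≼-mono t≤r r≼m) (≼-mono t≤1 (v≡ v-p)) (coprime-Bézout coprime))
      where
      coprime : Coprime m p
      coprime (d∣m , d∣p) with prime⇒irreducible isPrime d∣p
      ... | inj₁ d≡1  = d≡1
      ... | inj₂ refl = ⊥-elim (p∤m d∣m)
      difference : ∀ {t} a b → t ≼ ⟦ a ⟧ → t ≼ ⟦ b ⟧ → 1 ℕ.+ a ≡ b → t ≼ 1#
      difference a b ta tb eq = ≈[]-≼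
        (≈[]-sym (≈[]-resp (≈-reflexive (cong ⟦_⟧ eq)) (+-identityʳ 1#)
          (≈[]-+ (≈[]-reflexive (≈-refl {1#})) (≼⇒≈[]0 ta)))) tb
      multiple : ∀ {t n} k → t ≼ ⟦ n ⟧ → t ≼ ⟦ k ℕ.* n ⟧
      multiple k tn = ≼-resp (≈-sym (⟦⟧-* k _)) (≼-*ˡ (≼-⟦⟧ k) tn)
      one : ∀ {t} → t ≼ ⟦ m ⟧ → t ≼ ⟦ p ⟧ → Bézout.Identity 1 m p → t ≼ 1#
      one tm tp (Bézout.+- x y eq) = difference (y ℕ.* p) (x ℕ.* m) (multiple y tp) (multiple x tm) eq
      one tm tp (Bézout.-+ x y eq) = difference (x ℕ.* m) (y ℕ.* p) (multiple x tm) (multiple y tp) eq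

    v-p^ : ∀ N → v ⟦ p ℕ.^ N ⟧ ≡ [ fromℕ N ]
    v-p^ zero    = ≡.trans (v-cong (+-identityʳ 1#)) (≡.trans v-1 (cong [_] (≡.sym fromℕ-0)))
    v-p^ (suc N) = ≡.trans (v-⟦*⟧ p (p ℕ.^ N)) (≡.trans (cong₂ _+⁺_ v-p (v-p^ N))
      (cong [_] (≡.sym (≡.trans (fromℕ-+ 1 N) (cong (ℚ._+ fromℕ N) fromℕ-1)))))

    p≡suc : p ≡ suc (p ∸ 1)
    p≡suc = ≡.sym (ℕ.m+[n∸m]≡n {1} {p} (ℕ.≤-trans (ℕ.s≤s ℕ.z≤n) (ℕ.nonTrivial⇒n>1 p)))

    -- Legendre: v ((j + k p)!) = k + v (k!) for j < p.
    v-block : ∀ k j → j ℕ.< p → v ⟦ (j ℕ.+ k ℕ.* p) ! ⟧ ≡ [ fromℕ k ] +⁺ v ⟦ k ! ⟧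
    v-block zero zero j<p = ≡.sym (≡.trans (cong (λ a → [ a ] +⁺ v ⟦ 1 ⟧) fromℕ-0) (+⁺-identityˡ _))
    v-block (suc k) zero j<p = begin
      v ⟦ (p ℕ.+ k ℕ.* p) ! ⟧
        ≡⟨ cong (λ m → v ⟦ m ! ⟧) (cong (ℕ._+ k ℕ.* p) p≡suc) ⟩
      v ⟦ suc (p ∸ 1 ℕ.+ k ℕ.* p) ℕ.* (p ∸ 1 ℕ.+ k ℕ.* p) ! ⟧
        ≡⟨ cong (λ m → v ⟦ m ℕ.* (p ∸ 1 ℕ.+ k ℕ.* p) ! ⟧) (cong (ℕ._+ k ℕ.* p) (≡.sym p≡suc)) ⟩
      v ⟦ (suc k ℕ.* p) ℕ.* (p ∸ 1 ℕ.+ k ℕ.* p) ! ⟧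
        ≡⟨ v-⟦*⟧ (suc k ℕ.* p) ((p ∸ 1 ℕ.+ k ℕ.* p) !) ⟩
      v ⟦ suc k ℕ.* p ⟧ +⁺ v ⟦ (p ∸ 1 ℕ.+ k ℕ.* p) ! ⟧
        ≡⟨ cong₂ _+⁺_ (v-⟦*⟧ (suc k) p) (v-block k (p ∸ 1) (ℕ.≤-reflexive (≡.sym p≡suc))) ⟩
      (v ⟦ suc k ⟧ +⁺ v ⟦ p ⟧) +⁺ ([ fromℕ k ] +⁺ v ⟦ k ! ⟧)
        ≡⟨ cong (λ a → (v ⟦ suc k ⟧ +⁺ a) +⁺ ([ fromℕ k ] +⁺ v ⟦ k ! ⟧)) v-p ⟩
      (v ⟦ suc k ⟧ +⁺ [ 1ℚ ]) +⁺ ([ fromℕ k ] +⁺ v ⟦ k ! ⟧)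
        ≡⟨ cong (_+⁺ ([ fromℕ k ] +⁺ v ⟦ k ! ⟧)) (+⁺-comm (v ⟦ suc k ⟧) [ 1ℚ ]) ⟩
      ([ 1ℚ ] +⁺ v ⟦ suc k ⟧) +⁺ ([ fromℕ k ] +⁺ v ⟦ k ! ⟧)
        ≡⟨ swap (v ⟦ suc k ⟧) (v ⟦ k ! ⟧) ⟩
      [ 1ℚ ℚ.+ fromℕ k ] +⁺ (v ⟦ suc k ⟧ +⁺ v ⟦ k ! ⟧)
        ≡⟨ cong₂ _+⁺_ (cong [_] (≡.sym (≡.trans (fromℕ-+ 1 k) (cong (ℚ._+ fromℕ k) fromℕ-1)))) (≡.sym (v-⟦*⟧ (suc k) (k !))) ⟩
      [ fromℕ (suc k) ] +⁺ v ⟦ suc k ! ⟧ ∎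
      where
      open ≡.≡-Reasoning
      swap : ∀ a b → ([ 1ℚ ] +⁺ a) +⁺ ([ fromℕ k ] +⁺ b) ≡ [ 1ℚ ℚ.+ fromℕ k ] +⁺ (a +⁺ b)
      swap (just a) (just b) = cong [_] (solve 4 (λ o a k b → (o :+ a) :+ (k :+ b) := (o :+ k) :+ (a :+ b)) refl 1ℚ a (fromℕ k) b)
        where open +-*-Solver
      swap (just a) nothing  = refl
      swap nothing  b        = refl
    v-block k (suc j) j<p = ≡.trans (v-⟦*⟧ (suc j ℕ.+ k ℕ.* p) ((j ℕ.+ k ℕ.* p) !))
      (≡.trans (cong₂ _+⁺_ (v-∤ p∤) (v-block k j (ℕ.<-trans (ℕ.n<1+n j) j<p))) (+⁺-identityˡ _))
      where
      p∤ : p ∤ suc j ℕ.+ k ℕ.* p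
      p∤ p∣ = ℕ.<⇒≱ j<p (∣⇒≤ (∣m+n∣m⇒∣n (subst (p ∣_) (ℕ.+-comm (suc j) (k ℕ.* p)) p∣) (n∣m*n k)))

    v-! : ∀ n → ∃[ e ] v ⟦ n ! ⟧ ≡ [ fromℕ e ] × e ℕ.* (p ∸ 1) ℕ.≤ n ∸ 1
    v-! = <-rec _ go
      where
      go : ∀ n → (∀ {k} → k ℕ.< n → ∃[ e ] v ⟦ k ! ⟧ ≡ [ fromℕ e ] × e ℕ.* (p ∸ 1) ℕ.≤ k ∸ 1) →
           ∃[ e ] v ⟦ n ! ⟧ ≡ [ fromℕ e ] × e ℕ.* (p ∸ 1) ℕ.≤ n ∸ 1
      go n rec with n ℕ./ p | n ℕ.% p | m≡m%n+[m/n]*n n p | m%n<n n p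
      ... | zero  | j | refl | j<p = 0 , ≡.trans (v-block 0 j j<p)
            (≡.trans (cong₂ _+⁺_ (cong [_] fromℕ-0) (≡.trans (v-cong (+-identityʳ 1#)) v-1)) (cong [_] (≡.sym fromℕ-0))) , ℕ.z≤n
      ... | suc k | j | refl | j<p =
            let e , eq , le = rec k<n
            in suc k ℕ.+ e
             , ≡.trans (v-block (suc k) j j<p) (≡.trans (cong ([ fromℕ (suc k) ] +⁺_) eq) (cong [_] (≡.sym (fromℕ-+ (suc k) e))))
             , bound e le
        where
        P : ℕ
        P = p ∸ 1
        k<n : suc k ℕ.< j ℕ.+ suc k ℕ.* p
        k<n = ℕ.<-≤-trans (ℕ.m<m*n (suc k) p (ℕ.nonTrivial⇒n>1 p)) (ℕ.m≤n+m (suc k ℕ.* p) j)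
        bound : ∀ e → e ℕ.* P ℕ.≤ k → (suc k ℕ.+ e) ℕ.* P ℕ.≤ j ℕ.+ suc k ℕ.* p ∸ 1
        bound e le = begin
          (suc k ℕ.+ e) ℕ.* P         ≡⟨ ℕ.*-distribʳ-+ P (suc k) e ⟩
          suc k ℕ.* P ℕ.+ e ℕ.* P     ≤⟨ ℕ.+-monoʳ-≤ (suc k ℕ.* P) le ⟩
          suc k ℕ.* P ℕ.+ k           ≡⟨ ℕ.+-comm (suc k ℕ.* P) k ⟩
          suc k ℕ.+ suc k ℕ.* P ∸ 1   ≡⟨ cong (_∸ 1) (≡.sym (≡.trans (cong (suc k ℕ.*_) p≡suc) (ℕ.*-suc (suc k) P))) ⟩
          suc k ℕ.* p ∸ 1             ≤⟨ ℕ.∸-monoˡ-≤ 1 (ℕ.m≤n+m (suc k ℕ.* p) j) ⟩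
          j ℕ.+ suc k ℕ.* p ∸ 1       ∎
          where open ℕ.≤-Reasoning

    -- If v y ≥ t + m s then v (y / (m+1)!) ≥ t + m (s - 1/(p-1)).
    /!-bound : ∀ t s {y} m → t ℚ.+ fromℕ m ℚ.* s ≼ y →
               t ℚ.+ fromℕ m ℚ.* (s ℚ.- 1/[p-1] isPrime) ≼ y * ⟦ suc m ! ⟧ ⁻¹
    /!-bound t s m py with v-! (suc m)
    ... | e , eq , le = ≼-mono bound (≼-* py (v≡ (v-⁻¹ eq)))
      where
      τ : ℚ
      τ = 1/[p-1] isPrime
      e≤ : fromℕ e ℚ.≤ fromℕ m ℚ.* τ
      e≤ = *≤⇒≤*1/ e m (p ∸ 1) {{pred-nonZero}} le
      bound : t ℚ.+ fromℕ m ℚ.* (s ℚ.- τ) ℚ.≤ (t ℚ.+ fromℕ m ℚ.* s) ℚ.- fromℕ e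
      bound = subst (ℚ._≤ (t ℚ.+ fromℕ m ℚ.* s) ℚ.- fromℕ e)
        (solve 4 (λ t m s τ → (t :+ m :* s) :- (m :* τ) := t :+ m :* (s :- τ)) refl t (fromℕ m) s τ)
        (ℚ.+-monoʳ-≤ (t ℚ.+ fromℕ m ℚ.* s) (ℚ.neg-antimono-≤ e≤))
        where open +-*-Solver

    ⟦!⟧≉0 : ∀ n → ⟦ n ! ⟧ ≉ 0#
    ⟦!⟧≉0 n = v≢⊤⇒≉0 (proj₁ (proj₂ (v-! n)))

module Series (K : ValuedField c ℓ) (complete : ValuedField.Complete K) where
  open ValuedField K
  open ValuedFieldProperties K
  open AbelianGroupProperties +-abelianGroup using (xyx⁻¹≈y)

  lim : ∀ s → Cauchy s → Carrier
  lim s s-cauchy = proj₁ (complete s s-cauchy)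

  lim-⟶ : ∀ s (s-cauchy : Cauchy s) → s ⟶ lim s s-cauchy
  lim-⟶ s s-cauchy = proj₂ (complete s s-cauchy)

  Null : (ℕ → Carrier) → Set
  Null a = ∀ r → ∃[ N ] ∀ n → N ℕ.≤ n → r ≼ a n

  partialSum : (ℕ → Carrier) → ℕ → Carrier
  partialSum a n = ∑[ i < n ] a (toℕ i)

  opaque

    partialSum-cauchy : ∀ a → Null a → Cauchy (partialSum a)
    partialSum-cauchy a null = cauchy (partialSum a) λ r → let N , p = null r in N , λ n N≤n →
      ≼-resp (≈-sym (≈-trans (+-congʳ (sum-suc n a)) (xyx⁻¹≈y (partialSum a n) (a n)))) (p n N≤n)

  ∑∞ : ∀ a → Null a → Carrier
  ∑∞ a null = lim (partialSum a) (partialSum-cauchy a null)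

  opaque

    ∑∞-≼ : ∀ {r} a (null : Null a) → (∀ n → r ≼ a n) → r ≼ ∑∞ a null
    ∑∞-≼ a null p = ⟶-≼ (lim-⟶ (partialSum a) (partialSum-cauchy a null)) (λ n → ≼-sum n (a ∘ toℕ) (p ∘ toℕ))

    ∑∞-≈[] : ∀ {r} a b (a-null : Null a) (b-null : Null b) → (∀ n → a n ≈[ r ] b n) → ∑∞ a a-null ≈[ r ] ∑∞ b b-null
    ∑∞-≈[] a b a-null b-null p = ⟶-≈[]
      (lim-⟶ (partialSum a) (partialSum-cauchy a a-null)) (lim-⟶ (partialSum b) (partialSum-cauchy b b-null))
      (λ n → ≈[]-sum n (a ∘ toℕ) (b ∘ toℕ) (p ∘ toℕ))

module ExpLog (K : ValuedField c ℓ) (complete : ValuedField.Complete K) {p : ℕ} (isPrime : Prime p)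
              (v-p : ValuedField.v K (ValuedField.⟦_⟧ K p) ≡ [ 1ℚ ]) where
  open ValuedField K
  open ValuedFieldProperties K
  open NaturalNumbers K isPrime v-p
  open Series K complete

  private
    τ = 1/[p-1] isPrime

  opaque

    0≤τ : 0ℚ ℚ.≤ τ
    0≤τ = ≡.subst₂ ℚ._≤_ fromℕ-0 (≡.trans (cong (ℚ._* τ) fromℕ-1) (ℚ.*-identityˡ τ))
      (*≤⇒≤*1/ 0 1 (p ∸ 1) {{pred-nonZero {{prime⇒nonTrivial isPrime}}}} ℕ.z≤n)

    ≺⇒≼ : ∀ {x} → τ ≺ x → ∃[ s ] τ ℚ.< s × s ≼ x
    ≺⇒≼ {x} τ≺x = helper (v x) τ≺x
      where
      helper : ∀ a → [ τ ] <⁺ a → ∃[ s ] τ ℚ.< s × [ s ] ≤⁺ a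
      helper (just s) [ τ<s ] = s , τ<s , [ ℚ.≤-refl ]
      helper nothing  _       = τ ℚ.+ 1ℚ , subst (ℚ._< τ ℚ.+ 1ℚ) (ℚ.+-identityʳ τ) (ℚ.+-monoʳ-< τ (ℚ.positive⁻¹ 1ℚ)) , (_ ≤⊤⁺)

    ≼⇒≺ : ∀ {s x} → τ ℚ.< s → s ≼ x → τ ≺ x
    ≼⇒≺ {s} {x} τ<s s≼x = helper (v x) s≼x
      where
      helper : ∀ a → [ s ] ≤⁺ a → [ τ ] <⁺ a
      helper (just a) [ s≤a ] = [ ℚ.<-≤-trans τ<s s≤a ]
      helper nothing  _       = [ τ ]<⊤⁺

    0<s-τ : ∀ {s} → τ ℚ.< s → 0ℚ ℚ.< s ℚ.- τ
    0<s-τ {s} τ<s = subst (ℚ._< s ℚ.- τ) (ℚ.+-inverseʳ τ) (ℚ.+-monoˡ-< (ℚ.- τ) τ<s)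

    ≤+ : ∀ t {s} m → τ ℚ.< s → t ℚ.≤ t ℚ.+ fromℕ m ℚ.* (s ℚ.- τ)
    ≤+ t {s} m τ<s = subst (ℚ._≤ t ℚ.+ fromℕ m ℚ.* δ) (ℚ.+-identityʳ t) (ℚ.+-monoʳ-≤ t
      (subst (ℚ._≤ fromℕ m ℚ.* δ) (ℚ.*-zeroʳ (fromℕ m))
        (ℚ.*-monoˡ-≤-nonNeg (fromℕ m) {{ℚ.nonNegative (fromℕ-≥0 m)}} (ℚ.<⇒≤ (0<s-τ τ<s)))))
      where
      δ : ℚ
      δ = s ℚ.- τ

    linear-null : ∀ {s} (a : ℕ → Carrier) → τ ℚ.< s → (∀ m → s ℚ.+ fromℕ m ℚ.* (s ℚ.- τ) ≼ a m) → Null a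
    linear-null {s} a τ<s p r with archimedean (0<s-τ τ<s) (r ℚ.- s)
    ... | N , r-s≤ = N , λ n N≤n → ≼-mono (begin
      r                                   ≡⟨ solve 2 (λ r s → r := s :+ (r :- s)) refl r s ⟩
      s ℚ.+ (r ℚ.- s)                     ≤⟨ ℚ.+-monoʳ-≤ s r-s≤ ⟩
      s ℚ.+ fromℕ N ℚ.* (s ℚ.- τ)         ≤⟨ ℚ.+-monoʳ-≤ s (ℚ.*-monoʳ-≤-nonNeg (s ℚ.- τ)
                                               {{ℚ.nonNegative (ℚ.<⇒≤ (0<s-τ τ<s))}} (fromℕ-mono N≤n)) ⟩
      s ℚ.+ fromℕ n ℚ.* (s ℚ.- τ)         ∎) (p n)
      where
      open ℚ.≤-Reasoning
      open +-*-Solver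

    null-suc : ∀ a → Null (a ∘ suc) → Null a
    null-suc a null r with null r
    ... | N , p = suc N , λ { (suc n) (ℕ.s≤s N≤n) → p n N≤n }

  exp-term : Carrier → ℕ → Carrier
  exp-term x n = x ^ n * ⟦ n ! ⟧ ⁻¹

  opaque

    exp-term-≼ : ∀ {s x} → s ≼ x → ∀ m → s ℚ.+ fromℕ m ℚ.* (s ℚ.- τ) ≼ exp-term x (suc m)
    exp-term-≼ {s} s≼x m = /!-bound s s m (≼-* s≼x (≼-^ s≼x m))

    exp-null : ∀ x → τ ≺ x → Null (exp-term x)
    exp-null x τ≺x = let s , τ<s , s≼x = ≺⇒≼ τ≺x in null-suc (exp-term x) (linear-null (exp-term x ∘ suc) τ<s (exp-term-≼ s≼x))

  exp : ∀ x → τ ≺ x → Carrier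
  exp x τ≺x = ∑∞ (exp-term x) (exp-null x τ≺x)

  opaque

    v-1⁻¹ : v (⟦ 1 ⟧ ⁻¹) ≡ [ 0ℚ ]
    v-1⁻¹ = v-⁻¹ (≡.trans (v-cong (+-identityʳ 1#)) v-1)

    exp-≼ : ∀ x (τ≺x : τ ≺ x) → 0ℚ ≼ exp x τ≺x
    exp-≼ x τ≺x = ∑∞-≼ (exp-term x) (exp-null x τ≺x) λ where
      zero    → ≼-*ˡ ≼-1 (v≡ v-1⁻¹)
      (suc m) → let s , τ<s , s≼x = ≺⇒≼ τ≺x in
                ≼-mono (ℚ.≤-trans (ℚ.≤-trans 0≤τ (ℚ.<⇒≤ τ<s)) (≤+ s m τ<s)) (exp-term-≼ s≼x m)

    ^-≈[] : ∀ {d s x y} → s ≼ x → s ≼ y → x ≈[ d ] y → ∀ m → x ^ suc m ≈[ d ℚ.+ fromℕ m ℚ.* s ] y ^ suc m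
    ^-≈[] {d} {s} {x} {y} sx sy x≈y zero = subst (x ^ 1 ≈[_] y ^ 1) eq
      (≈[]-resp (≈-sym (*-identityʳ x)) (≈-sym (*-identityʳ y)) x≈y)
      where
      eq : d ≡ d ℚ.+ fromℕ 0 ℚ.* s
      eq = ≡.sym (≡.trans (cong (λ z → d ℚ.+ z ℚ.* s) fromℕ-0) (≡.trans (cong (d ℚ.+_) (ℚ.*-zeroˡ s)) (ℚ.+-identityʳ d)))
    ^-≈[] {d} {s} {x} {y} sx sy x≈y (suc m) = ≈[]-trans
      (subst (x * x ^ suc m ≈[_] x * y ^ suc m) eq (≈[]-*ˡ sx (^-≈[] sx sy x≈y m)))
      (≈[]-*ʳ x≈y (≼-^ sy (suc m)))
      where
      open +-*-Solver
      eq : s ℚ.+ (d ℚ.+ fromℕ m ℚ.* s) ≡ d ℚ.+ fromℕ (suc m) ℚ.* s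
      eq = ≡.trans (solve 3 (λ s d m → s :+ (d :+ m :* s) := d :+ (con 1ℚ :+ m) :* s) refl s d (fromℕ m))
             (cong (λ z → d ℚ.+ z ℚ.* s) (≡.sym (≡.trans (fromℕ-+ 1 m) (cong (ℚ._+ fromℕ m) fromℕ-1))))

    exp-≈[] : ∀ {d s x y} → τ ℚ.< s → s ≼ x → s ≼ y → x ≈[ d ] y → ∀ τ≺x τ≺y → exp x τ≺x ≈[ d ] exp y τ≺y
    exp-≈[] {d} {s} {x} {y} τ<s sx sy x≈y τ≺x τ≺y =
      ∑∞-≈[] (exp-term x) (exp-term y) (exp-null x τ≺x) (exp-null y τ≺y) λ where
        zero    → ≈[]-reflexive ≈-refl
        (suc m) → ≼-resp (*-distribʳ-− (⟦ suc m ! ⟧ ⁻¹) (x ^ suc m) (y ^ suc m))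
                    (≼-mono (≤+ d m τ<s) (/!-bound d s m (^-≈[] sx sy x≈y m)))

  -- log x = ∑ₙ (-1)ⁿ (x - 1)ⁿ⁺¹ / (n+1).  It converges for |x - 1| < 1; it is
  -- only needed where its value lies in the disc of convergence of exp.
  log-term : Carrier → ℕ → Carrier
  log-term x n = (- 1#) ^ n * ((x - 1#) ^ suc n * ⟦ suc n ⟧ ⁻¹)

  opaque

    ⁻¹-unique : ∀ {x y} → x ≉ 0# → x * y ≈ 1# → y ≈ x ⁻¹
    ⁻¹-unique {x} {y} x≉0 xy≈1 = begin
      y                 ≈⟨ *-identityʳ y ⟨
      y * 1#            ≈⟨ *-congˡ (*-inverseʳ x≉0) ⟨
      y * (x * x ⁻¹)    ≈⟨ *-assoc y x (x ⁻¹) ⟨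
      (y * x) * x ⁻¹    ≈⟨ *-congʳ (≈-trans (*-comm y x) xy≈1) ⟩
      1# * x ⁻¹         ≈⟨ *-identityˡ (x ⁻¹) ⟩
      x ⁻¹              ∎
      where open import Relation.Binary.Reasoning.Setoid setoid

    ⟦suc⟧≉0 : ∀ n → ⟦ suc n ⟧ ≉ 0#
    ⟦suc⟧≉0 n eq = ⟦!⟧≉0 (suc n) (≈-trans (⟦⟧-* (suc n) (n !)) (≈-trans (*-congʳ eq) (zeroˡ _)))

    ⟦suc⟧⁻¹ : ∀ n → ⟦ n ! ⟧ * ⟦ suc n ! ⟧ ⁻¹ ≈ ⟦ suc n ⟧ ⁻¹
    ⟦suc⟧⁻¹ n = ⁻¹-unique (⟦suc⟧≉0 n) (≈-trans (≈-sym (*-assoc ⟦ suc n ⟧ ⟦ n ! ⟧ (⟦ suc n ! ⟧ ⁻¹)))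
      (≈-trans (*-congʳ (≈-sym (⟦⟧-* (suc n) (n !)))) (*-inverseʳ (⟦!⟧≉0 (suc n)))))

    log-term-≼ : ∀ {s x} → s ≼ x - 1# → ∀ m → s ℚ.+ fromℕ m ℚ.* (s ℚ.- τ) ≼ log-term x m
    log-term-≼ {s} {x} sx m = ≼-*ˡ (≼-^0 ≼-−1 m) (≼-resp eq (≼-*ˡ (≼-⟦⟧ (m !)) (exp-term-≼ sx m)))
      where
      open import Relation.Binary.Reasoning.Setoid setoid
      y : Carrier
      y = (x - 1#) ^ suc m
      eq : ⟦ m ! ⟧ * exp-term (x - 1#) (suc m) ≈ y * ⟦ suc m ⟧ ⁻¹
      eq = begin
        ⟦ m ! ⟧ * (y * ⟦ suc m ! ⟧ ⁻¹)   ≈⟨ *-assoc ⟦ m ! ⟧ y _ ⟨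
        (⟦ m ! ⟧ * y) * ⟦ suc m ! ⟧ ⁻¹   ≈⟨ *-congʳ (*-comm ⟦ m ! ⟧ y) ⟩
        (y * ⟦ m ! ⟧) * ⟦ suc m ! ⟧ ⁻¹   ≈⟨ *-assoc y ⟦ m ! ⟧ _ ⟩
        y * (⟦ m ! ⟧ * ⟦ suc m ! ⟧ ⁻¹)   ≈⟨ *-congˡ (⟦suc⟧⁻¹ m) ⟩
        y * ⟦ suc m ⟧ ⁻¹                 ∎

    log-null : ∀ x → τ ≺ x - 1# → Null (log-term x)
    log-null x τ≺ = let s , τ<s , sx = ≺⇒≼ τ≺ in linear-null (log-term x) τ<s (log-term-≼ sx)

  log : ∀ x → τ ≺ x - 1# → Carrier
  log x τ≺ = ∑∞ (log-term x) (log-null x τ≺)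

  opaque

    log-≼ : ∀ {s} x (τ≺ : τ ≺ x - 1#) → τ ℚ.< s → s ≼ x - 1# → s ≼ log x τ≺
    log-≼ {s} x τ≺ τ<s sx = ∑∞-≼ (log-term x) (log-null x τ≺) λ m → ≼-mono (≤+ s m τ<s) (log-term-≼ sx m)

    log-≺ : ∀ x (τ≺ : τ ≺ x - 1#) → τ ≺ log x τ≺
    log-≺ x τ≺ = let s , τ<s , sx = ≺⇒≼ τ≺ in ≼⇒≺ τ<s (log-≼ x τ≺ τ<s sx)

    *-≺ : ∀ {x y} → 0ℚ ≼ x → τ ≺ y → τ ≺ x * y
    *-≺ 0≼x τ≺y = let s , τ<s , sy = ≺⇒≼ τ≺y in ≼⇒≺ τ<s (≼-*ˡ 0≼x sy)

  -- q^z = exp (z log q)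
  pow : ∀ q → τ ≺ q - 1# → 𝒪 K → Carrier
  pow q q≺ z = exp (elt z * log q q≺) (*-≺ (integral z) (log-≺ q q≺))

  opaque

    pow-≼ : ∀ q (q≺ : τ ≺ q - 1#) z → 0ℚ ≼ pow q q≺ z
    pow-≼ q q≺ ⟪ z , 0≼z ⟫ = exp-≼ (z * log q q≺) (*-≺ 0≼z (log-≺ q q≺))

    pow-≈[] : ∀ {d} q (q≺ : τ ≺ q - 1#) z w → elt z ≈[ d ] elt w → pow q q≺ z ≈[ d ] pow q q≺ w
    pow-≈[] {d} q q≺ ⟪ z , 0≼z ⟫ ⟪ w , 0≼w ⟫ z≈w =
      let s , τ<s , sL = ≺⇒≼ (log-≺ q q≺)
      in exp-≈[] τ<s (≼-*ˡ 0≼z sL) (≼-*ˡ 0≼w sL)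
           (≈[]-*ʳ0 z≈w (≼-mono (ℚ.≤-trans 0≤τ (ℚ.<⇒≤ τ<s)) sL)) _ _

module PowerSeries (K : ValuedField c ℓ) where
  open ValuedField K

  infixl 7 _⊛_
  _⊛_ : (ℕ → Carrier) → (ℕ → Carrier) → ℕ → Carrier
  (f ⊛ g) n = ∑[ i ≤ n ] (f (toℕ i) * g (n ∸ toℕ i))

  one : ℕ → Carrier
  one zero    = 1#
  one (suc _) = 0#

  power : (ℕ → Carrier) → ℕ → ℕ → Carrier
  power f zero    = one
  power f (suc k) = f ⊛ power f k

  -- ∑ₖ fᵏ / k! for a series f without constant term, so that only k ≤ n
  -- contribute to the coefficient of tⁿ.
  expˢ : (ℕ → Carrier) → ℕ → Carrier
  expˢ f n = ∑[ k ≤ n ] (power f (toℕ k) n * ⟦ toℕ k ! ⟧ ⁻¹)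

  log[1+_t] : Carrier → ℕ → Carrier
  log[1+ a t] zero    = 0#
  log[1+ a t] (suc n) = (- 1#) ^ n * (a ^ suc n * ⟦ suc n ⟧ ⁻¹)

  -- (1 + a t)^(z/a)
  degenerateExp : Carrier → Carrier → ℕ → Carrier
  degenerateExp a z = expˢ (λ n → (z * a ⁻¹) * log[1+ a t] n)

  -- z (z - a) ⋯ (z - (n-1) a)
  fallingFactorial : Carrier → Carrier → ℕ → Carrier
  fallingFactorial a z zero    = 1#
  fallingFactorial a z (suc n) = fallingFactorial a z n * (z - n · a)

module Continuity {p : ℕ} (C : PAdicTower p c ℓ) where
  open PAdicTower C
  open ValuedField ℂₚ
  open ValuedFieldProperties ℂₚ
  open PowerSeries ℂₚ
  private module ℚₚ = ValuedField ℚₚ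

  ℤₚ : Set _
  ℤₚ = 𝒪 ℚₚ

  -- ℤₚ is compact: a continuous function on it is bounded and uniformly
  -- continuous.
  record IsContinuous (f : ℤₚ → Carrier) : Set c where
    field
      bounded : ∃[ r ] ∀ y → r ≼ f y
      uniform : ∀ r → ∃[ s ] ∀ y z → elt y ℚₚ.≈[ s ] elt z → f y ≈[ r ] f z
  open IsContinuous public

  opaque

    const-continuous : ∀ a → IsContinuous (λ _ → a)
    const-continuous a .bounded = helper (v a)
      where
      helper : ∀ b → ∃[ r ] ((y : ℤₚ) → [ r ] ≤⁺ b)
      helper (just r) = r , λ _ → [ ℚ.≤-refl ]
      helper nothing  = 0ℚ , λ _ → _ ≤⊤⁺
    const-continuous a .uniform r = 0ℚ , λ _ _ _ → ≈[]-reflexive ≈-refl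

    +-continuous : ∀ {f g} → IsContinuous f → IsContinuous g → IsContinuous (λ y → f y + g y)
    +-continuous F G .bounded =
      let r , p = F .bounded
          s , q = G .bounded
      in r ℚ.⊓ s , λ y → ≼-+ (≼-mono (ℚ.p⊓q≤p r s) (p y)) (≼-mono (ℚ.p⊓q≤q r s) (q y))
    +-continuous F G .uniform r =
      let s , p = F .uniform r
          t , q = G .uniform r
      in s ℚ.⊔ t , λ y z y≈z → ≈[]-+ (p y z (ℚP.≈[]-mono (ℚ.p≤p⊔q s t) y≈z)) (q y z (ℚP.≈[]-mono (ℚ.p≤q⊔p s t) y≈z))
      where module ℚP = ValuedFieldProperties ℚₚ

    *-continuous : ∀ {f g} → IsContinuous f → IsContinuous g → IsContinuous (λ y → f y * g y)
    *-continuous F G .bounded =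
      let r , p = F .bounded
          s , q = G .bounded
      in r ℚ.+ s , λ y → ≼-* (p y) (q y)
    *-continuous {f} {g} F G .uniform r =
      let a , boundF = F .bounded
          b , boundG = G .bounded
          s , p = F .uniform (r ℚ.- b)
          t , q = G .uniform (r ℚ.- a)
      in s ℚ.⊔ t , λ y z y≈z → ≈[]-trans
           (subst (f y * g y ≈[_] f y * g z) (eqˡ r a) (≈[]-*ˡ (boundF y) (q y z (ℚP.≈[]-mono (ℚ.p≤q⊔p s t) y≈z))))
           (subst (f y * g z ≈[_] f z * g z) (eqʳ r b) (≈[]-*ʳ (p y z (ℚP.≈[]-mono (ℚ.p≤p⊔q s t) y≈z)) (boundG z)))
      where
      module ℚP = ValuedFieldProperties ℚₚ
      open +-*-Solver
      eqˡ : ∀ r a → a ℚ.+ (r ℚ.- a) ≡ r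
      eqˡ = solve 2 (λ r a → a :+ (r :- a) := r) refl
      eqʳ : ∀ r b → (r ℚ.- b) ℚ.+ b ≡ r
      eqʳ = solve 2 (λ r b → (r :- b) :+ b := r) refl

    sum-continuous : ∀ n (f : ℤₚ → Fin n → Carrier) → (∀ i → IsContinuous (λ y → f y i)) → IsContinuous (λ y → sum (f y))
    sum-continuous zero    f F = const-continuous 0#
    sum-continuous (suc n) f F = +-continuous (F zero) (sum-continuous n (λ y → f y ∘ suc) (F ∘ suc))

    power-continuous : ∀ (f : ℤₚ → ℕ → Carrier) → (∀ n → IsContinuous (λ y → f y n)) →
                       ∀ k n → IsContinuous (λ y → power (f y) k n)
    power-continuous f F zero    n = const-continuous (one n)
    power-continuous f F (suc k) n = sum-continuous (suc n) _ λ i →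
      *-continuous (F (toℕ i)) (power-continuous f F k (n ∸ toℕ i))

    expˢ-continuous : ∀ (f : ℤₚ → ℕ → Carrier) → (∀ n → IsContinuous (λ y → f y n)) →
                      ∀ n → IsContinuous (λ y → expˢ (f y) n)
    expˢ-continuous f F n = sum-continuous (suc n) _ λ k →
      *-continuous (power-continuous f F (toℕ k) n) (const-continuous (⟦ toℕ k ! ⟧ ⁻¹))

    degenerateExp-continuous : ∀ a {z} → IsContinuous z → ∀ n → IsContinuous (λ y → degenerateExp a (z y) n)
    degenerateExp-continuous a {z} Z = expˢ-continuous (λ y n → (z y * a ⁻¹) * log[1+ a t] n)
      λ n → *-continuous (*-continuous Z (const-continuous (a ⁻¹))) (const-continuous (log[1+ a t] n))

    fallingFactorial-continuous : ∀ a {z} → IsContinuous z → ∀ n → IsContinuous (λ y → fallingFactorial a (z y) n)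
    fallingFactorial-continuous a Z zero    = const-continuous 1#
    fallingFactorial-continuous a Z (suc n) = *-continuous (fallingFactorial-continuous a Z n)
      (+-continuous Z (const-continuous (- (n · a))))

module _ {K L : ValuedField c ℓ} (ι : Embedding K L) where
  private
    module K = ValuedField K
    module L = ValuedField L
  open IsRingHomomorphism (Embedding.isRingHomomorphism ι)

  opaque

    map-⟦⟧ : ∀ n → map ι K.⟦ n ⟧ L.≈ L.⟦ n ⟧
    map-⟦⟧ zero    = 0#-homo
    map-⟦⟧ (suc n) = L.≈-trans (+-homo K.1# K.⟦ n ⟧) (L.+-cong 1#-homo (map-⟦⟧ n))

    v-⟦⟧ : ∀ n → L.v L.⟦ n ⟧ ≡ K.v K.⟦ n ⟧
    v-⟦⟧ n = ≡.trans (L.v-cong (L.≈-sym (map-⟦⟧ n))) (Embedding.isometric ι K.⟦ n ⟧)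

    map-− : ∀ x y → map ι (x K.- y) L.≈ map ι x L.- map ι y
    map-− x y = L.≈-trans (+-homo x (K.- y)) (L.+-congˡ (-‿homo y))

    map-≈[] : ∀ {r x y} → x K.≈[ r ] y → map ι x L.≈[ r ] map ι y
    map-≈[] {r} {x} {y} = subst ([ r ] ≤⁺_)
      (≡.trans (≡.sym (Embedding.isometric ι (x K.- y))) (L.v-cong (map-− x y)))

    map-≼ : ∀ {r x} → r K.≼ x → r L.≼ map ι x
    map-≼ {r} {x} = subst ([ r ] ≤⁺_) (≡.sym (Embedding.isometric ι x))

module Fermionic {p : ℕ} (isPrime : Prime p) (2∤p : 2 ∤ p) (C : PAdicTower p c ℓ) where
  open PAdicTower C
  open ValuedField ℂₚ
  open ValuedFieldProperties ℂₚ
  open IsCompletion ι₂-isCompletion using (complete)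
  open Continuity C
  open PowerSeries ℂₚ
  private
    module ℚₚ = ValuedField ℚₚ
    module ℚP = ValuedFieldProperties ℚₚ
    module ℚN = NaturalNumbers ℚₚ isPrime v-p

  opaque

    v-p′ : v ⟦ p ⟧ ≡ [ 1ℚ ]
    v-p′ = ≡.trans (v-⟦⟧ ι₂ p) (≡.trans (v-⟦⟧ ι₁ p) v-p)

  open NaturalNumbers ℂₚ isPrime v-p′
  open Series ℂₚ complete
  open ExpLog ℂₚ complete isPrime v-p′

  ι : ℚₚ.Carrier → Carrier
  ι y = map ι₂ (map ι₁ y)

  ℕ→ℤₚ : ℕ → ℤₚ
  ℕ→ℤₚ n = ⟪ ℚₚ.⟦ n ⟧ , ℚP.≼-⟦⟧ n ⟫

  _⊞_ : 𝒪 ℂₚ → ℤₚ → 𝒪 ℂₚ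
  x ⊞ y = ⟪ elt x + ι (elt y) , ≼-+ (integral x) (map-≼ ι₂ (map-≼ ι₁ (integral y))) ⟫

  module Integral (q : Carrier) (|q-1|< : 1/[p-1] isPrime ≺ q - 1#) where

    q^_ : 𝒪 ℂₚ → Carrier
    q^_ = pow q |q-1|<

    [_]q : 𝒪 ℂₚ → Carrier
    [ z ]q = (1# - q^ z) * (1# - q) ⁻¹

    [_]-q : ℕ → Carrier
    [ N ]-q = (1# - (- q) ^ N) * (1# + q) ⁻¹

    riemannSum : (ℤₚ → Carrier) → ℕ → Carrier
    riemannSum f N = [ p ℕ.^ N ]-q ⁻¹ * ∑[ y < p ℕ.^ N ] (f (ℕ→ℤₚ (toℕ y)) * (- q) ^ toℕ y)

    private
      a = - q

    opaque

      0≼q : 0ℚ ≼ q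
      0≼q = let s , τ<s , sq = ≺⇒≼ |q-1|< in ≈[]-≼ {y = 1#} (≼-mono (ℚ.≤-trans 0≤τ (ℚ.<⇒≤ τ<s)) sq) ≼-1

      0≼a : 0ℚ ≼ a
      0≼a = ≼-neg 0≼q

      v-unit : ∀ {s x y} → 0ℚ ℚ.< s → x ≈[ s ] y → v y ≡ [ 0ℚ ] → v x ≡ [ 0ℚ ]
      v-unit {s} {x} {y} 0<s x≈y vy = v≡0 (≈[]-≼ (≼-mono (ℚ.<⇒≤ 0<s) x≈y) (v≡ vy)) λ r 0<r r≼x →
        let t , 0<t , t≤r , t≤s = positive-≤ r s 0<r 0<s
        in contradiction′ 0<t (subst ([ t ] ≤⁺_) vy (≈[]-≼ (≈[]-sym (≼-mono t≤s x≈y)) (≼-mono t≤r r≼x)))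
        where
        contradiction′ : ∀ {t} → 0ℚ ℚ.< t → ¬ [ t ] ≤⁺ [ 0ℚ ]
        contradiction′ 0<t [ t≤0 ] = ℚ.<-irrefl refl (ℚ.<-≤-trans 0<t t≤0)

      v-2 : v (1# + 1#) ≡ [ 0ℚ ]
      v-2 = ≡.trans (v-cong (+-congˡ (≈-sym (+-identityʳ 1#)))) (v-∤ p∤2)
        where
        p∤2 : p ∤ 2
        p∤2 p∣2 = 2∤p (subst (2 ∣_) (ℕ.≤-antisym (ℕ.nonTrivial⇒n>1 p {{prime⇒nonTrivial isPrime}}) (∣⇒≤ p∣2)) ∣-refl)

    open AbelianGroupProperties +-abelianGroup using () renaming (⁻¹-involutive to -‿involutive)

    opaque

      [-1]^p^N : ∀ N → (- 1#) ^ (p ℕ.^ N) ≈ - 1#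
      [-1]^p^N zero    = *-identityʳ (- 1#)
      [-1]^p^N (suc N) = ≈-trans (≈-sym (^-assocʳ (- 1#) p (p ℕ.^ N))) (≈-trans (^-congˡ (p ℕ.^ N) [-1]^p) ([-1]^p^N N))
        where
        open Exp semiring using (^-assocʳ; ^-congˡ)
        even : ∀ k → (- 1#) ^ (k ℕ.* 2) ≈ 1#
        even zero    = ≈-refl
        even (suc k) = ≈-trans (≈-sym (*-assoc (- 1#) (- 1#) _)) (≈-trans (*-congʳ -1*-1≈1) (≈-trans (*-identityˡ _) (even k)))
        odd : ∀ r k → r ℕ.< 2 → p ≡ r ℕ.+ k ℕ.* 2 → (- 1#) ^ p ≈ - 1#
        odd zero          k _ eq = ⊥-elim (2∤p (divides k eq))
        odd (suc zero)    k _ eq = ≈-trans (≈-reflexive (cong ((- 1#) ^_) eq)) (≈-trans (*-congˡ (even k)) (*-identityʳ (- 1#)))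
        odd (suc (suc _)) k (ℕ.s≤s (ℕ.s≤s ())) eq
        [-1]^p : (- 1#) ^ p ≈ - 1#
        [-1]^p = odd (p ℕ.% 2) (p ℕ./ 2) (m%n<n p 2) (m≡m%n+[m/n]*n p 2)

      a≈-1 : ∃[ s ] 0ℚ ℚ.< s × a ≈[ s ] - 1#
      a≈-1 = let s , τ<s , sq = ≺⇒≼ |q-1|< in s , ℚ.≤-<-trans 0≤τ τ<s , ≈[]-neg sq

      a^-≈[] : ∀ {s} → a ≈[ s ] - 1# → ∀ n → a ^ n ≈[ s ] (- 1#) ^ n
      a^-≈[] a≈ zero    = ≈[]-reflexive ≈-refl
      a^-≈[] a≈ (suc n) = ≈[]-trans (≈[]-*ˡ0 0≼a (a^-≈[] a≈ n)) (≈[]-*ʳ0 a≈ (≼-^0 ≼-−1 n))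

      v-1+q : v (1# + q) ≡ [ 0ℚ ]
      v-1+q = let s , τ<s , sq = ≺⇒≼ |q-1|< in v-unit (ℚ.≤-<-trans 0≤τ τ<s) (≈[]-+ (≈[]-reflexive ≈-refl) sq) v-2

      v-1-a^ : ∀ N → v (1# - a ^ (p ℕ.^ N)) ≡ [ 0ℚ ]
      v-1-a^ N = let s , 0<s , a≈ = a≈-1 in v-unit 0<s
        (≈[]-+ (≈[]-reflexive ≈-refl) (≈[]-resp ≈-refl (≈-trans (-‿cong ([-1]^p^N N)) (-‿involutive 1#)) (≈[]-neg (a^-≈[] a≈ (p ℕ.^ N)))))
        v-2

      v-[p^]-q : ∀ N → v [ p ℕ.^ N ]-q ≡ [ 0ℚ ]
      v-[p^]-q N = ≡.trans (v-* _ _) (cong₂ _+⁺_ (v-1-a^ N) (v-⁻¹ v-1+q))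

    -- ∑_{j<i} x^j
    geometric : Carrier → ℕ → Carrier
    geometric x zero    = 0#
    geometric x (suc i) = 1# + x * geometric x i

    opaque

      geometric-sum : ∀ x i → (1# - x) * geometric x i ≈ 1# - x ^ i
      geometric-sum x zero    = ≈-trans (zeroʳ _) (≈-sym (-‿inverseʳ 1#))
      geometric-sum x (suc i) = begin
        (1# - x) * (1# + x * G)                ≈⟨ distribˡ (1# - x) 1# (x * G) ⟩
        (1# - x) * 1# + (1# - x) * (x * G)     ≈⟨ +-cong (*-identityʳ (1# - x)) (≈-trans (≈-sym (*-assoc _ x G)) (≈-trans (*-congʳ (*-comm _ x)) (*-assoc x _ G))) ⟩
        (1# - x) + x * ((1# - x) * G)          ≈⟨ +-congˡ (*-congˡ (geometric-sum x i)) ⟩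
        (1# - x) + x * (1# - x ^ i)            ≈⟨ +-congˡ (≈-trans (*-distribˡ-− x 1# (x ^ i)) (+-congʳ (*-identityʳ x))) ⟩
        (1# - x) + (x - x * x ^ i)             ≈⟨ +-assoc 1# (- x) _ ⟩
        1# + (- x + (x - x * x ^ i))           ≈⟨ +-congˡ (+-assoc (- x) x _) ⟨
        1# + ((- x + x) - x * x ^ i)           ≈⟨ +-congˡ (≈-trans (+-congʳ (-‿inverseˡ x)) (+-identityˡ _)) ⟩
        1# - x * x ^ i                         ∎
        where
        open import Relation.Binary.Reasoning.Setoid setoid
        G : Carrier
        G = geometric x i

      [*]-q : ∀ i M → [ M ]-q * geometric (a ^ M) i ≈ [ i ℕ.* M ]-q
      [*]-q i M = begin
        ((1# - a ^ M) * w) * geometric (a ^ M) i   ≈⟨ *-assoc _ w _ ⟩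
        (1# - a ^ M) * (w * geometric (a ^ M) i)   ≈⟨ *-congˡ (*-comm w _) ⟩
        (1# - a ^ M) * (geometric (a ^ M) i * w)   ≈⟨ *-assoc _ _ w ⟨
        ((1# - a ^ M) * geometric (a ^ M) i) * w   ≈⟨ *-congʳ (geometric-sum (a ^ M) i) ⟩
        (1# - (a ^ M) ^ i) * w                     ≈⟨ *-congʳ (+-congˡ (-‿cong (≈-trans (^-assocʳ a M i) (^-congʳ a (ℕ.*-comm M i))))) ⟩
        (1# - a ^ (i ℕ.* M)) * w                   ∎
        where
        open import Relation.Binary.Reasoning.Setoid setoid
        open Exp semiring using (^-assocʳ; ^-congʳ)
        w : Carrier
        w = (1# + q) ⁻¹

    blockSum : (ℕ → Carrier) → ℕ → Carrier
    blockSum g M = ∑[ y < M ] (g (toℕ y) * a ^ toℕ y)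

    opaque

      blockSum-≈[] : ∀ {r} (g : ℕ → Carrier) M → (∀ k y → g (k ℕ.* M ℕ.+ y) ≈[ r ] g y) → ∀ i k →
                     blockSum (λ y → g (k ℕ.* M ℕ.+ y)) (i ℕ.* M) ≈[ r ] geometric (a ^ M) i * blockSum g M
      blockSum-≈[] g M g-≈ zero    k = ≈[]-reflexive (≈-sym (zeroˡ _))
      blockSum-≈[] {r} g M g-≈ (suc i) k = ≈[]-resp (≈-sym split) (≈-sym (distribʳ _ 1# _)) (≈[]-+ first rest)
        where
        open import Relation.Binary.Reasoning.Setoid setoid
        open Exp semiring using (^-homo-*)
        h : ℕ → Carrier
        h y = g (k ℕ.* M ℕ.+ y) * a ^ y
        tail : ℕ → Carrier
        tail y = g (suc k ℕ.* M ℕ.+ y)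
        index : ∀ y → k ℕ.* M ℕ.+ (M ℕ.+ y) ≡ suc k ℕ.* M ℕ.+ y
        index y = ≡.trans (≡.sym (ℕ.+-assoc (k ℕ.* M) M y)) (cong (ℕ._+ y) (ℕ.+-comm (k ℕ.* M) M))
        shift : ∀ y → h (M ℕ.+ y) ≈ a ^ M * (tail y * a ^ y)
        shift y = begin
          g (k ℕ.* M ℕ.+ (M ℕ.+ y)) * a ^ (M ℕ.+ y)  ≈⟨ *-cong (≈-reflexive (cong g (index y))) (^-homo-* a M y) ⟩
          tail y * (a ^ M * a ^ y)                    ≈⟨ *-assoc (tail y) (a ^ M) (a ^ y) ⟨
          (tail y * a ^ M) * a ^ y                    ≈⟨ *-congʳ (*-comm (tail y) (a ^ M)) ⟩
          (a ^ M * tail y) * a ^ y                    ≈⟨ *-assoc (a ^ M) (tail y) (a ^ y) ⟩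
          a ^ M * (tail y * a ^ y)                    ∎
        split : ∑[ y < suc i ℕ.* M ] h (toℕ y) ≈ blockSum (λ y → g (k ℕ.* M ℕ.+ y)) M + a ^ M * blockSum tail (i ℕ.* M)
        split = ≈-trans (sum-split M (i ℕ.* M) h) (+-congˡ
          (≈-trans (Sum.sum-cong-≋ semiring {i ℕ.* M} (λ y → shift (toℕ y)))
                   (≈-sym (Sum.*-distribˡ-sum semiring {i ℕ.* M} (a ^ M) (λ y → tail (toℕ y) * a ^ toℕ y)))))
        first : blockSum (λ y → g (k ℕ.* M ℕ.+ y)) M ≈[ r ] 1# * blockSum g M
        first = ≈[]-resp ≈-refl (≈-sym (*-identityˡ _))
          (≈[]-sum M _ _ λ y → ≈[]-*ʳ0 (g-≈ k (toℕ y)) (≼-^0 0≼a (toℕ y)))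
        rest : a ^ M * blockSum tail (i ℕ.* M) ≈[ r ] (a ^ M * geometric (a ^ M) i) * blockSum g M
        rest = ≈[]-resp ≈-refl (≈-sym (*-assoc _ _ _)) (≈[]-*ˡ0 (≼-^0 0≼a M) (blockSum-≈[] g M g-≈ i (suc k)))

      riemannSum-step : ∀ {r} f N → (∀ k y → f (ℕ→ℤₚ (k ℕ.* p ℕ.^ N ℕ.+ y)) ≈[ r ] f (ℕ→ℤₚ y)) →
                        riemannSum f (suc N) ≈[ r ] riemannSum f N
      riemannSum-step {r} f N f-≈ = ≈[]-resp ≈-refl eq
        (≈[]-*ˡ0 (v≡ (v-⁻¹ (v-[p^]-q (suc N)))) (blockSum-≈[] (f ∘ ℕ→ℤₚ) M f-≈ p 0))
        where
        open import Relation.Binary.Reasoning.Setoid setoid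
        M : ℕ
        M = p ℕ.^ N
        T : Carrier
        T = blockSum (f ∘ ℕ→ℤₚ) M
        G : Carrier
        G = geometric (a ^ M) p
        W : Carrier
        W = [ p ℕ.* M ]-q ⁻¹
        W*G : W * G ≈ [ M ]-q ⁻¹
        W*G = ⁻¹-unique (v≢⊤⇒≉0 (v-[p^]-q N)) (begin
          [ M ]-q * (W * G)         ≈⟨ *-congˡ (*-comm W G) ⟩
          [ M ]-q * (G * W)         ≈⟨ *-assoc [ M ]-q G W ⟨
          ([ M ]-q * G) * W         ≈⟨ *-congʳ ([*]-q p M) ⟩
          [ p ℕ.* M ]-q * W         ≈⟨ *-inverseʳ (v≢⊤⇒≉0 (v-[p^]-q (suc N))) ⟩
          1#                        ∎)
        eq : W * (G * T) ≈ riemannSum f N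
        eq = ≈-trans (≈-sym (*-assoc W G T)) (*-congʳ W*G)

      riemannSum-cauchy : ∀ {f} → IsContinuous f → Cauchy (riemannSum f)
      riemannSum-cauchy {f} F = cauchy (riemannSum f) λ r →
        let s , unif = F .uniform r
            N₀ , s≤N₀ = *1-archimedean s
        in N₀ , λ N N₀≤N → riemannSum-step f N λ k y → unif _ _ (near N k y (ℚ.≤-trans s≤N₀ (fromℕ-mono N₀≤N)))
        where
        open AbelianGroupProperties ℚₚ.+-abelianGroup using (xyx⁻¹≈y)
        near : ∀ {s} N k y → s ℚ.≤ fromℕ N → ℚₚ.⟦ k ℕ.* p ℕ.^ N ℕ.+ y ⟧ ℚₚ.≈[ s ] ℚₚ.⟦ y ⟧
        near N k y s≤N = ℚP.≼-resp
          (ℚₚ.≈-sym (ℚₚ.≈-trans (ℚₚ.+-congʳ (ℚₚ.≈-trans (ℚN.⟦⟧-+ (k ℕ.* p ℕ.^ N) y) (ℚₚ.+-comm _ _))) (xyx⁻¹≈y ℚₚ.⟦ y ⟧ _)))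
          (ℚP.≼-resp (ℚₚ.≈-sym (ℚN.⟦⟧-* k (p ℕ.^ N))) (ℚP.≼-*ˡ (ℚP.≼-⟦⟧ k) (ℚP.≼-mono s≤N (ℚP.v≡ (ℚN.v-p^ N)))))

    -- The integral against μ_{-q}, as the limit of its Riemann sums.
    ∫ : ∀ f → IsContinuous f → Carrier
    ∫ f F = lim (riemannSum f) (riemannSum-cauchy F)

    opaque

      [x+y]q-continuous : ∀ x → IsContinuous (λ y → [ x ⊞ y ]q)
      [x+y]q-continuous x = *-continuous
        (+-continuous (const-continuous 1#) neg-q^) (const-continuous ((1# - q) ⁻¹))
        where
        neg-q^ : IsContinuous (λ y → - (q^ (x ⊞ y)))
        neg-q^ .bounded = 0ℚ , λ y → ≼-neg (pow-≼ q |q-1|< (x ⊞ y))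
        neg-q^ .uniform r = r , λ y z y≈z → ≈[]-neg (pow-≈[] q |q-1|< (x ⊞ y) (x ⊞ z)
          (≈[]-+ (≈[]-reflexive ≈-refl) (map-≈[] ι₂ (map-≈[] ι₁ y≈z))))

      [x+y]q-falling-continuous : ∀ l x n → IsContinuous (λ y → fallingFactorial l [ x ⊞ y ]q n)
      [x+y]q-falling-continuous l x = fallingFactorial-continuous l ([x+y]q-continuous x)

      [x+y]q-degenerateExp-continuous : ∀ l x n → IsContinuous (λ y → degenerateExp l [ x ⊞ y ]q n)
      [x+y]q-degenerateExp-continuous l x = degenerateExp-continuous l ([x+y]q-continuous x)

    -- Eₙ from ∑ₙ Eₙ tⁿ / n! = ∫ (1 + l t)^([x+y]_q / l) dμ_{-q}(y).
    degenerateEuler : Carrier → 𝒪 ℂₚ → ℕ → Carrier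
    degenerateEuler l x n = ⟦ n ! ⟧ *
      ∫ (λ y → degenerateExp l [ x ⊞ y ]q n) ([x+y]q-degenerateExp-continuous l x n)

{-# OPTIONS --safe #-}

-- For fixed z the coefficients Eₙ of (1 + a t)^(z/a) = exp (z/a · log (1 + a t))
-- satisfy t E' = (z/a) t (log (1 + a t))' E, where the coefficients of
-- (z/a) (log (1 + a t))' are z (-a)ⁱ.  Hence (1 + a t) E' = z E, that is
-- (n+1) Eₙ₊₁ = (z - n a) Eₙ, and n! Eₙ is the degenerate falling factorial.
-- So the two integrands agree up to the factor n!, which passes through the
-- Riemann sums and their limit.
module Submission where

open import Level using (Level)
import Algebra.Properties.AbelianGroup as AbelianGroupProperties
import Algebra.Properties.CommutativeSemigroup as CommutativeSemigroupProperties
import Algebra.Properties.Ring as RingProperties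
import Algebra.Properties.Semiring.Mult as Mult
import Algebra.Properties.Semiring.Sum as Sum
import Algebra.Solver.Ring.NaturalCoefficients.Default as NaturalCoefficients
open import Data.Empty using (⊥-elim)
open import Data.Fin.Base using (Fin; toℕ)
open import Data.Fin.Properties using (toℕ<n)
open import Data.Maybe.Base using (just; nothing)
open import Data.Nat.Base as ℕ using (ℕ; zero; suc; _∸_; _!; NonZero)
open import Data.Nat.Divisibility using (_∤_)
open import Data.Nat.Primality using (Prime)
import Data.Nat.Properties as ℕ
open import Data.Product.Base using (_,_)
open import Data.Rational.Base as ℚ using (0ℚ; 1ℚ)
import Data.Rational.Properties as ℚ
open import Function.Base using (_∘_)
open import Function.Bundles using (Equivalence)
open import Relation.Binary.PropositionalEquality as ≡ using (_≡_; refl; cong)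
import Relation.Binary.Construct.Add.Supremum.NonStrict as Supremum≤
open import Relation.Nullary.Construct.Add.Supremum using ([_]; ⊤⁺)
open import Defs

open Supremum≤ ℚ._≤_ using (_≤⁺_; [_])

private variable
  c ℓ : Level

-- Limits for the valuation: uniqueness and scaling.

≤⁺-unbounded⇒⊤⁺ : ∀ a → (∀ r → [ r ] ≤⁺ a) → a ≡ ⊤⁺
≤⁺-unbounded⇒⊤⁺ nothing  _ = refl
≤⁺-unbounded⇒⊤⁺ (just s) h with h (s ℚ.+ 1ℚ)
... | [ s+1≤s ] = ⊥-elim (ℚ.<-irrefl refl (ℚ.<-≤-trans s<s+1 s+1≤s))
  where
  s<s+1 : s ℚ.< s ℚ.+ 1ℚ
  s<s+1 = ≡.subst (ℚ._< s ℚ.+ 1ℚ) (ℚ.+-identityʳ s) (ℚ.+-monoʳ-< s (ℚ.positive⁻¹ 1ℚ))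

module Limits (K : ValuedField c ℓ) where
  open ValuedField K
  open ValuedFieldProperties K
  open AbelianGroupProperties +-abelianGroup using () renaming (x∙y⁻¹≈ε⇒x≈y to x-y≈0⇒x≈y)

  -- Closeness at every precision forces the difference to have infinite valuation, and only zero
  -- has it.
  ≈[]-unbounded⇒≈ : ∀ {x y} → (∀ r → x ≈[ r ] y) → x ≈ y
  ≈[]-unbounded⇒≈ {x} {y} h = x-y≈0⇒x≈y x y (Equivalence.to (v-zero (x - y)) (≤⁺-unbounded⇒⊤⁺ _ h))

  -- Completeness only supplies some limit, so two integrals are compared through this uniqueness.
  ⟶-unique : ∀ {s t L M} → s ⟶ L → t ⟶ M → (∀ n → s n ≈ t n) → L ≈ M
  ⟶-unique s⟶L t⟶M s≈t = ≈[]-unbounded⇒≈ λ r → ⟶-≈[] s⟶L t⟶M λ n → ≈[]-reflexive (s≈t n)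

  -- A factor of absolute value at most 1 does not enlarge errors, so the same `N` serves.
  *-⟶ : ∀ {x s L} → 0ℚ ≼ x → s ⟶ L → (λ n → x * s n) ⟶ (x * L)
  *-⟶ 0≼x s⟶L r = let N , h = s⟶L r in N , λ n N≤n → ≈[]-*ˡ0 0≼x (h n N≤n)

-- Convolution of formal power series, the operator t d/dt, and truncated exponentials.

module PowerSeriesProperties (K : ValuedField c ℓ) where
  open ValuedField K
  open ValuedFieldProperties K using (sum-suc; sum-split)
  open PowerSeries K
  open Mult semiring using (×-homo-+)
  open Sum semiring using (sum-cong-≋; sum-replicate-zero; *-distribˡ-sum; ∑-distrib-+)
  open CommutativeSemigroupProperties *-commutativeSemigroup using (x∙yz≈y∙xz)
  open NaturalCoefficients commutativeSemiring using (solve; _:+_; _:*_; _:=_; con)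
  open import Relation.Binary.Reasoning.Setoid setoid

  sum-zero : ∀ n {f : Fin n → Carrier} → (∀ i → f i ≈ 0#) → sum f ≈ 0#
  sum-zero n f≈0 = ≈-trans (sum-cong-≋ {n} f≈0) (sum-replicate-zero n)

  -- The second factors are compared only up to index `n`, because truncated exponentials agree with
  -- `expˢ` only at low indices.
  ⊛-cong : ∀ {f f′ g g′} n → (∀ i → f i ≈ f′ i) → (∀ i → i ℕ.≤ n → g i ≈ g′ i) → (f ⊛ g) n ≈ (f′ ⊛ g′) n
  ⊛-cong n f≈f′ g≈g′ = sum-cong-≋ {suc n} λ i → *-cong (f≈f′ (toℕ i)) (g≈g′ (n ∸ toℕ i) (ℕ.m∸n≤m n (toℕ i)))

  ⊛-congʳ : ∀ {f f′} g n → (∀ i → f i ≈ f′ i) → (f ⊛ g) n ≈ (f′ ⊛ g) n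
  ⊛-congʳ g n f≈f′ = ⊛-cong {g = g} {g} n f≈f′ λ _ _ → ≈-refl

  ⊛-congˡ : ∀ f {g g′} n → (∀ i → g i ≈ g′ i) → (f ⊛ g) n ≈ (f ⊛ g′) n
  ⊛-congˡ f n g≈g′ = ⊛-cong {f} {f} n (λ _ → ≈-refl) λ i _ → g≈g′ i

  ⊛-zeroʳ : ∀ f g n → (∀ i → i ℕ.≤ n → g i ≈ 0#) → (f ⊛ g) n ≈ 0#
  ⊛-zeroʳ f g n g≈0 = sum-zero (suc n) λ i → ≈-trans (*-congˡ (g≈0 (n ∸ toℕ i) (ℕ.m∸n≤m n (toℕ i)))) (zeroʳ (f (toℕ i)))

  ⊛-distribˡ : ∀ f g h n → (f ⊛ (λ m → g m + h m)) n ≈ (f ⊛ g) n + (f ⊛ h) n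
  ⊛-distribˡ f g h n = ≈-trans
    (sum-cong-≋ {suc n} λ i → distribˡ (f (toℕ i)) (g (n ∸ toℕ i)) (h (n ∸ toℕ i)))
    (∑-distrib-+ {suc n} (λ i → f (toℕ i) * g (n ∸ toℕ i)) (λ i → f (toℕ i) * h (n ∸ toℕ i)))

  ⊛-distribʳ : ∀ h f g n → ((λ m → f m + g m) ⊛ h) n ≈ (f ⊛ h) n + (g ⊛ h) n
  ⊛-distribʳ h f g n = ≈-trans
    (sum-cong-≋ {suc n} λ i → distribʳ (h (n ∸ toℕ i)) (f (toℕ i)) (g (toℕ i)))
    (∑-distrib-+ {suc n} (λ i → f (toℕ i) * h (n ∸ toℕ i)) (λ i → g (toℕ i) * h (n ∸ toℕ i)))

  *-⊛ : ∀ x f g n → ((λ m → x * f m) ⊛ g) n ≈ x * (f ⊛ g) n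
  *-⊛ x f g n = ≈-trans
    (sum-cong-≋ {suc n} λ i → *-assoc x (f (toℕ i)) (g (n ∸ toℕ i)))
    (≈-sym (*-distribˡ-sum {suc n} x λ i → f (toℕ i) * g (n ∸ toℕ i)))

  ⊛-* : ∀ x f g n → (f ⊛ (λ m → x * g m)) n ≈ x * (f ⊛ g) n
  ⊛-* x f g n = ≈-trans
    (sum-cong-≋ {suc n} λ i → x∙yz≈y∙xz (f (toℕ i)) x (g (n ∸ toℕ i)))
    (≈-sym (*-distribˡ-sum {suc n} x λ i → f (toℕ i) * g (n ∸ toℕ i)))

  -- By definition the sum unfolds at its first term, with `f 0`. Unfolding it at the last, with
  -- `g 0`, is what the induction for commutativity requires.
  ⊛-suc : ∀ f g n → (f ⊛ g) (suc n) ≈ (f ⊛ (g ∘ suc)) n + f (suc n) * g 0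
  ⊛-suc f g zero    = solve 2 (λ x y → x :+ (y :+ con 0) := (x :+ con 0) :+ y) ≈-refl _ _
  ⊛-suc f g (suc n) = ≈-trans (+-congˡ (⊛-suc (f ∘ suc) g n)) (≈-sym (+-assoc _ _ _))

  ⊛-comm : ∀ f g n → (f ⊛ g) n ≈ (g ⊛ f) n
  ⊛-comm f g zero    = +-congʳ (*-comm (f 0) (g 0))
  ⊛-comm f g (suc n) = begin
    f 0 * g (suc n) + ((f ∘ suc) ⊛ g) n   ≈⟨ +-cong (*-comm _ _) (⊛-comm (f ∘ suc) g n) ⟩
    g (suc n) * f 0 + (g ⊛ (f ∘ suc)) n   ≈⟨ +-comm _ _ ⟩
    (g ⊛ (f ∘ suc)) n + g (suc n) * f 0   ≈⟨ ⊛-suc g f n ⟨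
    (g ⊛ f) (suc n)                       ∎

  -- Induction on `n` for all `f` at once: splitting off `f 0` replaces `f` by its shift and lowers
  -- the index by one.
  ⊛-assoc : ∀ f g h n → ((f ⊛ g) ⊛ h) n ≈ (f ⊛ (g ⊛ h)) n
  ⊛-assoc f g h zero    = solve 3 (λ f g h → (f :* g :+ con 0) :* h :+ con 0 := f :* (g :* h :+ con 0) :+ con 0) ≈-refl _ _ _
  ⊛-assoc f g h (suc n) = begin
    (f ⊛ g) 0 * h (suc n) + ((λ m → f 0 * g (suc m) + (f′ ⊛ g) m) ⊛ h) n
      ≈⟨ +-congˡ (⊛-distribʳ h (λ m → f 0 * g′ m) (f′ ⊛ g) n) ⟩
    (f ⊛ g) 0 * h (suc n) + (((λ m → f 0 * g′ m) ⊛ h) n + ((f′ ⊛ g) ⊛ h) n)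
      ≈⟨ +-congˡ (+-cong (*-⊛ (f 0) g′ h n) (⊛-assoc f′ g h n)) ⟩
    (f 0 * g 0 + 0#) * h (suc n) + (f 0 * (g′ ⊛ h) n + (f′ ⊛ (g ⊛ h)) n)
      ≈⟨ solve 5 (λ f g h x y → (f :* g :+ con 0) :* h :+ (f :* x :+ y) := f :* (g :* h :+ x) :+ y) ≈-refl _ _ _ _ _ ⟩
    f 0 * (g 0 * h (suc n) + (g′ ⊛ h) n) + (f′ ⊛ (g ⊛ h)) n ∎
    where
    f′ g′ : ℕ → Carrier
    f′ = f ∘ suc
    g′ = g ∘ suc

  ⊛-swap : ∀ f g h n → (f ⊛ (g ⊛ h)) n ≈ (g ⊛ (f ⊛ h)) n
  ⊛-swap f g h n = begin
    (f ⊛ (g ⊛ h)) n   ≈⟨ ⊛-assoc f g h n ⟨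
    ((f ⊛ g) ⊛ h) n   ≈⟨ ⊛-congʳ h n (⊛-comm f g) ⟩
    ((g ⊛ f) ⊛ h) n   ≈⟨ ⊛-assoc g f h n ⟩
    (g ⊛ (f ⊛ h)) n   ∎

  -- The Euler operator t d/dt: unlike d/dt it does not shift the index, so
  -- its Leibniz rule holds term by term.
  θ : (ℕ → Carrier) → ℕ → Carrier
  θ f n = ⟦ n ⟧ * f n

  θ-⊛ : ∀ f g n → θ (f ⊛ g) n ≈ (θ f ⊛ g) n + (f ⊛ θ g) n
  θ-⊛ f g n = begin
    ⟦ n ⟧ * (f ⊛ g) n                                         ≈⟨ *-distribˡ-sum {suc n} ⟦ n ⟧ (λ i → f (toℕ i) * g (n ∸ toℕ i)) ⟩
    ∑[ i ≤ n ] (⟦ n ⟧ * (f (toℕ i) * g (n ∸ toℕ i)))          ≈⟨ sum-cong-≋ {suc n} term ⟩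
    ∑[ i ≤ n ] (θ f (toℕ i) * g (n ∸ toℕ i) + f (toℕ i) * θ g (n ∸ toℕ i))
                                                              ≈⟨ ∑-distrib-+ {suc n} (λ i → θ f (toℕ i) * g (n ∸ toℕ i)) (λ i → f (toℕ i) * θ g (n ∸ toℕ i)) ⟩
    (θ f ⊛ g) n + (f ⊛ θ g) n                                 ∎
    where
    term : ∀ (i : Fin (suc n)) → ⟦ n ⟧ * (f (toℕ i) * g (n ∸ toℕ i)) ≈
                                 θ f (toℕ i) * g (n ∸ toℕ i) + f (toℕ i) * θ g (n ∸ toℕ i)
    term i = begin
      -- The weight `n` is the sum of the two indices `j` and `n ∸ j` in the term.
      ⟦ n ⟧ * (f j * g (n ∸ j))                        ≡⟨ cong (λ m → ⟦ m ⟧ * (f j * g (n ∸ j))) (ℕ.m+[n∸m]≡n (ℕ.s≤s⁻¹ (toℕ<n i))) ⟨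
      ⟦ j ℕ.+ (n ∸ j) ⟧ * (f j * g (n ∸ j))            ≈⟨ *-congʳ (×-homo-+ 1# j (n ∸ j)) ⟩
      (⟦ j ⟧ + ⟦ n ∸ j ⟧) * (f j * g (n ∸ j))          ≈⟨ solve 4 (λ a b f g → (a :+ b) :* (f :* g) := (a :* f) :* g :+ f :* (b :* g)) ≈-refl _ _ _ _ ⟩
      θ f j * g (n ∸ j) + f j * θ g (n ∸ j)            ∎
      where
      j : ℕ
      j = toℕ i

  θ-one : ∀ n → θ one n ≈ 0#
  θ-one zero    = zeroˡ _
  θ-one (suc n) = zeroʳ _

  -- The chain rule for powers, by induction with the Leibniz rule; `⊛-swap` brings `θ f` to the
  -- front so that the two summands combine.
  θ-power : ∀ f k n → θ (power f (suc k)) n ≈ ⟦ suc k ⟧ * (θ f ⊛ power f k) n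
  θ-power f zero n = begin
    θ (f ⊛ one) n                    ≈⟨ θ-⊛ f one n ⟩
    (θ f ⊛ one) n + (f ⊛ θ one) n    ≈⟨ +-congˡ (⊛-zeroʳ f (θ one) n λ i _ → θ-one i) ⟩
    (θ f ⊛ one) n + 0#               ≈⟨ solve 1 (λ x → x :+ con 0 := (con 1 :+ con 0) :* x) ≈-refl _ ⟩
    ⟦ 1 ⟧ * (θ f ⊛ one) n            ∎
  θ-power f (suc k) n = begin
    θ (f ⊛ fᵏ) n                                          ≈⟨ θ-⊛ f fᵏ n ⟩
    (θ f ⊛ fᵏ) n + (f ⊛ θ fᵏ) n                           ≈⟨ +-congˡ (⊛-congˡ f n (θ-power f k)) ⟩
    (θ f ⊛ fᵏ) n + (f ⊛ (λ m → ⟦ suc k ⟧ * (θ f ⊛ power f k) m)) n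
                                                          ≈⟨ +-congˡ (⊛-* ⟦ suc k ⟧ f (θ f ⊛ power f k) n) ⟩
    (θ f ⊛ fᵏ) n + ⟦ suc k ⟧ * (f ⊛ (θ f ⊛ power f k)) n  ≈⟨ +-congˡ (*-congˡ (⊛-swap f (θ f) (power f k) n)) ⟩
    (θ f ⊛ fᵏ) n + ⟦ suc k ⟧ * (θ f ⊛ fᵏ) n               ≈⟨ solve 2 (λ x y → x :+ y :* x := (con 1 :+ y) :* x) ≈-refl _ _ ⟩
    ⟦ suc (suc k) ⟧ * (θ f ⊛ fᵏ) n                        ∎
    where
    fᵏ : ℕ → Carrier
    fᵏ = power f (suc k)

  -- Each factor without constant term raises the order of the product by at least one.
  power-order : ∀ f → f 0 ≈ 0# → ∀ {n k} → n ℕ.< k → power f k n ≈ 0#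
  power-order f f0≈0 {zero}  {suc k} _         = ≈-trans (+-identityʳ _) (≈-trans (*-congʳ f0≈0) (zeroˡ _))
  power-order f f0≈0 {suc n} {suc k} (ℕ.s≤s n<k) = begin
    f 0 * power f k (suc n) + ((f ∘ suc) ⊛ power f k) n
      ≈⟨ +-cong (≈-trans (*-congʳ f0≈0) (zeroˡ _))
                (⊛-zeroʳ (f ∘ suc) (power f k) n λ i i≤n → power-order f f0≈0 (ℕ.≤-<-trans i≤n n<k)) ⟩
    0# + 0#   ≈⟨ +-identityˡ 0# ⟩
    0#        ∎

  -- In `expˢ` the number of summands grows with the coefficient index. Fixing it at `N` gives a
  -- partial sum of the exponential series that admits induction on `N`.
  expPartial : (ℕ → Carrier) → ℕ → ℕ → Carrier
  expPartial f N n = ∑[ k < N ] (power f (toℕ k) n * ⟦ toℕ k ! ⟧ ⁻¹)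

  -- The summands with exponent above `n` vanish at index `n` by `power-order`.
  expPartial-stable : ∀ f → f 0 ≈ 0# → ∀ {n N} → n ℕ.< N → expPartial f N n ≈ expˢ f n
  expPartial-stable f f0≈0 {n} {N} n<N = begin
    expPartial f N n                         ≡⟨ cong (λ M → expPartial f M n) (ℕ.m+[n∸m]≡n n<N) ⟨
    expPartial f (suc n ℕ.+ (N ∸ suc n)) n   ≈⟨ sum-split (suc n) (N ∸ suc n) (λ k → power f k n * ⟦ k ! ⟧ ⁻¹) ⟩
    expˢ f n + _                             ≈⟨ +-congˡ (sum-zero (N ∸ suc n) λ i →
                                                  ≈-trans (*-congʳ (power-order f f0≈0 (ℕ.s≤s (ℕ.m≤m+n n (toℕ i))))) (zeroˡ _)) ⟩
    expˢ f n + 0#                            ≈⟨ +-identityʳ _ ⟩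
    expˢ f n                                 ∎

-- Differentiating the formal exponential in characteristic zero.

HasCharacteristicZero : ValuedField c ℓ → Set ℓ
HasCharacteristicZero K = ∀ n → .{{NonZero n}} → ⟦ n ⟧ ≉ 0#
  where open ValuedField K

module CharacteristicZero (K : ValuedField c ℓ) (⟦⟧≉0 : HasCharacteristicZero K) where
  open ValuedField K
  open ValuedFieldProperties K using (sum-suc; *-distribʳ-−)
  open PowerSeries K
  open PowerSeriesProperties K
  open Mult semiring using (×1-homo-*; ×-assoc-*; ×-congʳ)
  open RingProperties ring using (-0#≈0#; -1*x≈-x)
  open NaturalCoefficients commutativeSemiring using (solve; _:+_; _:*_; _:=_; con)
  open import Relation.Binary.Reasoning.Setoid setoid

  ⟦suc⟧*⟦suc!⟧⁻¹ : ∀ k → ⟦ suc k ⟧ * ⟦ suc k ! ⟧ ⁻¹ ≈ ⟦ k ! ⟧ ⁻¹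
  ⟦suc⟧*⟦suc!⟧⁻¹ k = begin
    s * w                         ≈⟨ *-identityʳ _ ⟨
    -- Inserting `f * f ⁻¹` lets `s * f` fuse into the larger factorial, which cancels `w`.
    s * w * 1#                    ≈⟨ *-congˡ (*-inverseʳ (⟦⟧≉0 (k !) {{k ℕ.!≢0}})) ⟨
    s * w * (f * f ⁻¹)            ≈⟨ solve 4 (λ s w f g → s :* w :* (f :* g) := (s :* f) :* w :* g) ≈-refl s w f (f ⁻¹) ⟩
    (s * f) * w * f ⁻¹            ≈⟨ *-congʳ (*-congʳ (×1-homo-* (suc k) (k !))) ⟨
    ⟦ suc k ! ⟧ * w * f ⁻¹        ≈⟨ *-congʳ (*-inverseʳ (⟦⟧≉0 (suc k !) {{suc k ℕ.!≢0}})) ⟩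
    1# * f ⁻¹                     ≈⟨ *-identityˡ _ ⟩
    f ⁻¹                          ∎
    where
    s w f : Carrier
    s = ⟦ suc k ⟧
    w = ⟦ suc k ! ⟧ ⁻¹
    f = ⟦ k ! ⟧

  -- The operator sends f^(k+1)/(k+1)! to `θ f` times f^k/k! and kills the constant term, so it
  -- lowers the truncation by one.
  θ-expPartial : ∀ f N n → θ (expPartial f (suc N)) n ≈ (θ f ⊛ expPartial f N) n
  θ-expPartial f zero n = begin
    ⟦ n ⟧ * (one n * ⟦ 1 ⟧ ⁻¹ + 0#)   ≈⟨ solve 3 (λ n o w → n :* (o :* w :+ con 0) := (n :* o) :* w) ≈-refl _ _ _ ⟩
    θ one n * ⟦ 1 ⟧ ⁻¹                ≈⟨ ≈-trans (*-congʳ (θ-one n)) (zeroˡ _) ⟩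
    0#                                ≈⟨ ⊛-zeroʳ (θ f) (λ _ → 0#) n (λ _ _ → ≈-refl) ⟨
    (θ f ⊛ (λ _ → 0#)) n              ∎
  θ-expPartial f (suc N) n = begin
    ⟦ n ⟧ * expPartial f (suc (suc N)) n
      ≈⟨ *-congˡ (sum-suc (suc N) (λ k → power f k n * ⟦ k ! ⟧ ⁻¹)) ⟩
    ⟦ n ⟧ * (expPartial f (suc N) n + power f (suc N) n * w)
      ≈⟨ solve 4 (λ n e p w → n :* (e :+ p :* w) := n :* e :+ (n :* p) :* w) ≈-refl _ _ _ w ⟩
    θ (expPartial f (suc N)) n + θ (power f (suc N)) n * w
      ≈⟨ +-cong (θ-expPartial f N n) (*-congʳ (θ-power f N n)) ⟩
    (θ f ⊛ expPartial f N) n + (⟦ suc N ⟧ * (θ f ⊛ power f N) n) * w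
      ≈⟨ +-congˡ (solve 3 (λ s x w → (s :* x) :* w := (s :* w) :* x) ≈-refl _ _ w) ⟩
    (θ f ⊛ expPartial f N) n + (⟦ suc N ⟧ * w) * (θ f ⊛ power f N) n
      ≈⟨ +-congˡ (*-congʳ (⟦suc⟧*⟦suc!⟧⁻¹ N)) ⟩
    (θ f ⊛ expPartial f N) n + ⟦ N ! ⟧ ⁻¹ * (θ f ⊛ power f N) n
      ≈⟨ +-congˡ (⊛-* (⟦ N ! ⟧ ⁻¹) (θ f) (power f N) n) ⟨
    (θ f ⊛ expPartial f N) n + (θ f ⊛ (λ m → ⟦ N ! ⟧ ⁻¹ * power f N m)) n
      ≈⟨ ⊛-distribˡ (θ f) (expPartial f N) (λ m → ⟦ N ! ⟧ ⁻¹ * power f N m) n ⟨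
    (θ f ⊛ (λ m → expPartial f N m + ⟦ N ! ⟧ ⁻¹ * power f N m)) n
      ≈⟨ ⊛-congˡ (θ f) n (λ m → ≈-trans (+-congˡ (*-comm _ _)) (≈-sym (sum-suc N (λ k → power f k m * ⟦ k ! ⟧ ⁻¹)))) ⟩
    (θ f ⊛ expPartial f (suc N)) n ∎
    where
    w : Carrier
    w = ⟦ suc N ! ⟧ ⁻¹

  -- At index `suc n` the series `expˢ f` is the partial sum of n+2 terms, and `θ` leaves n+1. These
  -- suffice: `θ f` vanishes at index 0, so the convolution meets only indices up to `n`.
  θ-expˢ : ∀ f → f 0 ≈ 0# → ∀ n → θ (expˢ f) (suc n) ≈ ((θ f ∘ suc) ⊛ expˢ f) n
  θ-expˢ f f0≈0 n = begin
    θ (expˢ f) (suc n)                                 ≈⟨ θ-expPartial f (suc n) (suc n) ⟩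
    (0# * f 0) * _ + ((θ f ∘ suc) ⊛ expPartial f (suc n)) n
                                                       ≈⟨ solve 3 (λ f e x → (con 0 :* f) :* e :+ x := x) ≈-refl _ _ _ ⟩
    ((θ f ∘ suc) ⊛ expPartial f (suc n)) n             ≈⟨ ⊛-cong {θ f ∘ suc} n (λ _ → ≈-refl) (λ i i≤n → expPartial-stable f f0≈0 (ℕ.s≤s i≤n)) ⟩
    ((θ f ∘ suc) ⊛ expˢ f) n                           ∎

  -- The recurrence for the coefficients of (1 + a t)^(z/a).

  module _ (a : Carrier) (a≉0 : a ≉ 0#) (z : Carrier) where

    private
      -- `f` is the exponent (z/a) log(1 + a t), and `g` is its derivative z/(1 + a t) as a
      -- geometric series of ratio -a.
      f g E : ℕ → Carrier
      f n = (z * a ⁻¹) * log[1+ a t] n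
      g n = z * ((- 1#) ^ n * a ^ n)
      E = degenerateExp a z

    -- The weight n+1 cancels the denominator of the logarithm, and `a ⁻¹` cancels one of the n+1
    -- factors `a`.
    θ-scaledLog : ∀ n → θ f (suc n) ≈ g n
    θ-scaledLog n = begin
      ⟦ suc n ⟧ * ((z * a ⁻¹) * (s * ((a * a ^ n) * ⟦ suc n ⟧ ⁻¹)))
        ≈⟨ solve 7 (λ m z a′ s a aⁿ m′ → m :* ((z :* a′) :* (s :* ((a :* aⁿ) :* m′))) := (m :* m′) :* ((a :* a′) :* (z :* (s :* aⁿ))))
                   ≈-refl ⟦ suc n ⟧ z (a ⁻¹) s a (a ^ n) (⟦ suc n ⟧ ⁻¹) ⟩
      (⟦ suc n ⟧ * ⟦ suc n ⟧ ⁻¹) * ((a * a ⁻¹) * g n)   ≈⟨ *-cong (*-inverseʳ (⟦⟧≉0 (suc n))) (*-congʳ (*-inverseʳ a≉0)) ⟩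
      1# * (1# * g n)                                   ≈⟨ ≈-trans (*-identityˡ _) (*-identityˡ _) ⟩
      g n                                               ∎
      where
      s : Carrier
      s = (- 1#) ^ n

    θ-degenerateExp : ∀ n → θ E (suc n) ≈ (g ⊛ E) n
    θ-degenerateExp n = ≈-trans (θ-expˢ f (zeroʳ _) n) (⊛-congʳ E n θ-scaledLog)

    g-suc : ∀ n → g (suc n) ≈ (- 1# * a) * g n
    g-suc n = solve 5 (λ z m s a aⁿ → z :* ((m :* s) :* (a :* aⁿ)) := (m :* a) :* (z :* (s :* aⁿ)))
                ≈-refl z (- 1#) ((- 1#) ^ n) a (a ^ n)

    -- After the first term of `g ⊛ E` is split off, the geometric ratio turns the rest into -a
    -- times the same convolution one index lower, which is again `θ E`. The convolution thus
    -- collapses to a two-term recurrence.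
    degenerateExp-suc : ∀ n → ⟦ suc n ⟧ * E (suc n) ≈ (z - n · a) * E n
    degenerateExp-suc zero = begin
      θ E 1                                  ≈⟨ θ-degenerateExp 0 ⟩
      z * (1# * 1#) * E 0 + 0#               ≈⟨ solve 2 (λ z e → (z :* (con 1 :* con 1)) :* e :+ con 0 := z :* e) ≈-refl z (E 0) ⟩
      z * E 0                                ≈⟨ *-congʳ (≈-trans (+-congˡ -0#≈0#) (+-identityʳ z)) ⟨
      (z - 0#) * E 0                         ∎
    degenerateExp-suc (suc n) = begin
      θ E (suc (suc n))                                              ≈⟨ θ-degenerateExp (suc n) ⟩
      z * (1# * 1#) * E (suc n) + ((g ∘ suc) ⊛ E) n                  ≈⟨ +-cong (*-congʳ (≈-trans (*-congˡ (*-identityˡ 1#)) (*-identityʳ z))) (⊛-congʳ E n g-suc) ⟩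
      z * E (suc n) + ((λ m → (- 1# * a) * g m) ⊛ E) n               ≈⟨ +-congˡ (*-⊛ (- 1# * a) g E n) ⟩
      z * E (suc n) + (- 1# * a) * (g ⊛ E) n                         ≈⟨ +-congˡ (*-congˡ (θ-degenerateExp n)) ⟨
      z * E (suc n) + (- 1# * a) * (⟦ suc n ⟧ * E (suc n))           ≈⟨ +-congˡ (solve 4 (λ o a m e → (o :* a) :* (m :* e) := o :* ((m :* a) :* e)) ≈-refl (- 1#) a ⟦ suc n ⟧ (E (suc n))) ⟩
      -- The product with a numeral becomes the repeated sum `suc n · a` that occurs in
      -- `fallingFactorial`.
      z * E (suc n) + - 1# * ((⟦ suc n ⟧ * a) * E (suc n))           ≈⟨ +-congˡ (*-congˡ (*-congʳ (≈-trans (×-assoc-* (suc n) 1# a) (×-congʳ (suc n) (*-identityˡ a))))) ⟩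
      z * E (suc n) + - 1# * ((suc n · a) * E (suc n))               ≈⟨ +-congˡ (-1*x≈-x _) ⟩
      z * E (suc n) - (suc n · a) * E (suc n)                        ≈⟨ *-distribʳ-− _ _ _ ⟨
      (z - suc n · a) * E (suc n)                                    ∎

    -- Both sides obey the same first-order recurrence: the factor `⟦ suc n ⟧` from
    -- `degenerateExp-suc` is absorbed into the factorial.
    fallingFactorial≈!*degenerateExp : ∀ n → fallingFactorial a z n ≈ ⟦ n ! ⟧ * E n
    fallingFactorial≈!*degenerateExp zero = begin
      1#                                     ≈⟨ *-inverseʳ (⟦⟧≉0 1) ⟨
      -- `E 0` unfolds to the single summand of `expˢ` with exponent 0, followed by the empty sum.
      ⟦ 1 ⟧ * ⟦ 1 ⟧ ⁻¹                       ≈⟨ *-congˡ (solve 1 (λ w → w := con 1 :* w :+ con 0) ≈-refl _) ⟩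
      ⟦ 1 ⟧ * (1# * ⟦ 1 ⟧ ⁻¹ + 0#)           ∎
    fallingFactorial≈!*degenerateExp (suc n) = begin
      fallingFactorial a z n * (z - n · a)   ≈⟨ *-congʳ (fallingFactorial≈!*degenerateExp n) ⟩
      (⟦ n ! ⟧ * E n) * (z - n · a)          ≈⟨ ≈-trans (*-assoc _ _ _) (*-congˡ (*-comm _ _)) ⟩
      ⟦ n ! ⟧ * ((z - n · a) * E n)          ≈⟨ *-congˡ (degenerateExp-suc n) ⟨
      ⟦ n ! ⟧ * (⟦ suc n ⟧ * E (suc n))      ≈⟨ solve 3 (λ f m e → f :* (m :* e) := (m :* f) :* e) ≈-refl _ _ _ ⟩
      (⟦ suc n ⟧ * ⟦ n ! ⟧) * E (suc n)      ≈⟨ *-congʳ (×1-homo-* (suc n) (n !)) ⟨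
      ⟦ suc n ! ⟧ * E (suc n)                ∎

theorem2p3 : ∀ {c ℓ} {p : ℕ} (isPrime : Prime p) (2∤p : 2 ∤ p) (C : PAdicTower p c ℓ) →
    let open PAdicTower C
        open ValuedField ℂₚ
        open PowerSeries ℂₚ
        open Fermionic isPrime 2∤p C
    in
    (q : Carrier) → q ≉ 1# → (|q-1|< : 1/[p-1] isPrime ≺ q - 1#) →
    let open Integral q |q-1|<
    in
    (l : Carrier) → l ≉ 0# → (x : 𝒪 ℂₚ) (n : ℕ) →
    ∫ (λ y → fallingFactorial l [ x ⊞ y ]q n) ([x+y]q-falling-continuous l x n)
      ≈ degenerateEuler l x n
theorem2p3 {p = p} isPrime 2∤p C q _ |q-1|< l l≉0 x n =
  -- Both sides are limits of Riemann sums. As a natural number, `n !` has absolute value at most 1,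
  -- so `*-⟶` carries it through the limit.
  ⟶-unique (lim-⟶ _ _) (*-⟶ (≼-⟦⟧ (n !)) (lim-⟶ _ _)) riemannSum-*
  where
  open PAdicTower C
  open ValuedField ℂₚ
  open ValuedFieldProperties ℂₚ using (≼-⟦⟧)
  open PowerSeries ℂₚ
  open Fermionic isPrime 2∤p C
  open Integral q |q-1|<
  open IsCompletion ι₂-isCompletion using (complete)
  open Series ℂₚ complete using (lim-⟶)
  open ExpLog ℂₚ complete isPrime v-p′ using (⟦suc⟧≉0)
  open Limits ℂₚ
  open Sum semiring using (sum-cong-≋; *-distribˡ-sum)
  open CommutativeSemigroupProperties *-commutativeSemigroup using (x∙yz≈y∙xz)

  ⟦⟧≉0 : HasCharacteristicZero ℂₚ
  -- Nonvanishing comes from the finite valuation of factorials.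
  ⟦⟧≉0 (suc m) = ⟦suc⟧≉0 m

  open CharacteristicZero ℂₚ ⟦⟧≉0 using (fallingFactorial≈!*degenerateExp)

  riemannSum-* : ∀ N → riemannSum (λ y → fallingFactorial l [ x ⊞ y ]q n) N ≈
                       ⟦ n ! ⟧ * riemannSum (λ y → degenerateExp l [ x ⊞ y ]q n) N
  -- The identity of integrands is applied at each sample point; `n !` then leaves the finite sum
  -- and moves past the normalising factor.
  riemannSum-* N = ≈-trans (*-congˡ (≈-trans
    (sum-cong-≋ {p ℕ.^ N} λ y → ≈-trans (*-congʳ (fallingFactorial≈!*degenerateExp l l≉0 _ n)) (*-assoc _ _ _))
    (≈-sym (*-distribˡ-sum {p ℕ.^ N} ⟦ n ! ⟧ _)))) (x∙yz≈y∙xz _ _ _)
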